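{- Let $\mathbb{R}^d=V\oplus W$ with $\dim V=\ell$ and $\dim W=d-\ell$. Let $K\subseteq V$ and $L\subseteq W$ be convex bodies (in $V$ and $W$ respectively) that contain the origin, and let $\Lambda\subseteq V$ and $\Gamma\subseteq W$ be lattices. Then for every $i\in\{1,\dots,d\}$, $$\mu_i(K\oplus L,\Lambda\oplus\Gamma)=\max_{\substack{0\le j\le \ell\\ 0\le i-j\le d-\ell}}\Big(\mu_j(K,\Lambda)+\mu_{i-j}(L,\Gamma)\Big).$$
   Context: A convex body in a real vector space is a full-dimensional compact convex subset; a lattice is a full-rank discrete subgroup. The direct sum of $K\subseteq V$ and $L\subseteq W$ (both containing the origin) is $K\oplus L=\{\lambda x+(1-\lambda)y: x\in K,\ y\in L,\ \lambda\in[0,1]\}\subseteq\mathbb{R}^d$, and $\Lambda\oplus\Gamma=\{a+b: a\in\Lambda,\ b\in\Gamma\}$. For a $k$-dimensional real vector space $E$, a lattice $\Gamma'\subseteq E$, a convex body $C\subseteq E$ and $i\in\{1,\dots,k\}$, the $i$-th covering minimum is $\mu_i(C,\Gamma')=\min\{\mu\ge 0: (\mu C+\Gamma')\cap U\neq\emptyset$ for every affine subspace $U\subseteq E$ of dimension $k-i\}$; by convention $\mu_0(C,\Gamma')=0$. Covering minima of $K,\Lambda$ are taken in $V$, those of $L,\Gamma$ in $W$. -}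

module Defs where

open import Level using (Lift; 0ℓ) renaming (suc to lsuc)
open import Algebra.Core using (Op₁; Op₂)
open import Algebra.Bundles using (CommutativeRing)
open import Algebra.Structures using (IsCommutativeRing)
open import Data.Fin.Base using (Fin)
open import Data.List.Base using (List)
open import Data.List.Relation.Unary.Any using (Any)
open import Data.Nat.Base as ℕ using (ℕ; zero; suc; _∸_)
open import Data.Product using (Σ-syntax; ∃-syntax; _×_)
open import Data.Unit.Base using (⊤)
open import Data.Vec.Functional using (Vector)
open import Relation.Binary.Core using (Rel)
open import Relation.Binary.Definitions using (_Respects_)
open import Relation.Binary.Structures using (IsTotalOrder)
open import Relation.Nullary using (¬_)
open import Relation.Unary using (Pred; _∈_; _⊆_; _≐_; _∩_; Satisfiable)

-- The real numbers, characterised (uniquely up to isomorphism) as a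
-- Dedekind-complete totally ordered field.  Equality is a setoid equality.

record RealNumbers : Set₁ where
  infix  8 -_
  infixl 7 _*_
  infixl 6 _+_
  infix  4 _≈_ _≤_ _<_

  field
    Carrier           : Set
    _≈_               : Rel Carrier 0ℓ
    _≤_               : Rel Carrier 0ℓ
    _+_               : Op₂ Carrier
    _*_               : Op₂ Carrier
    -_                : Op₁ Carrier
    0#                : Carrier
    1#                : Carrier
    isCommutativeRing : IsCommutativeRing _≈_ _+_ _*_ -_ 0# 1#
    0≉1               : ¬ (0# ≈ 1#)
    inverse           : ∀ x → ¬ (x ≈ 0#) → ∃[ y ] (x * y ≈ 1#)
    isTotalOrder      : IsTotalOrder _≈_ _≤_
    +-monoˡ-≤         : ∀ z {x y} → x ≤ y → x + z ≤ y + z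
    *-nonNegative     : ∀ {x y} → 0# ≤ x → 0# ≤ y → 0# ≤ x * y

  UpperBound : ∀ {p} → Pred Carrier p → Carrier → Set p
  UpperBound P u = ∀ x → x ∈ P → x ≤ u

  field
    complete : (P : Pred Carrier 0ℓ) → Satisfiable P → ∃[ u ] UpperBound P u →
               ∃[ s ] (UpperBound P s × (∀ u → UpperBound P u → s ≤ u))

  commutativeRing : CommutativeRing 0ℓ 0ℓ
  commutativeRing = record { isCommutativeRing = isCommutativeRing }

  open CommutativeRing commutativeRing public using (setoid; _-_; +-monoid)

  _<_ : Rel Carrier 0ℓ
  x < y = x ≤ y × ¬ (x ≈ y)

  IsMaximum : ∀ {p} → Pred Carrier p → Carrier → Set p
  IsMaximum P m = m ∈ P × (∀ x → x ∈ P → x ≤ m)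

  IsMinimum : ∀ {p} → Pred Carrier p → Carrier → Set p
  IsMinimum P m = m ∈ P × (∀ x → x ∈ P → m ≤ x)

module Geometry (ℝ : RealNumbers) where

  open RealNumbers ℝ
  open import Algebra.Properties.Monoid.Sum +-monoid using (sum)
  open import Data.Vec.Functional.Relation.Binary.Equality.Setoid setoid using (_≋_)

  ℝ^ : ℕ → Set
  ℝ^ d = Vector Carrier d

  Subset : ℕ → Set₁
  Subset d = Pred (ℝ^ d) 0ℓ

  infixl 7 _·ᵥ_
  infixl 6 _+ᵥ_ _-ᵥ_

  _+ᵥ_ : ∀ {d} → ℝ^ d → ℝ^ d → ℝ^ d
  (x +ᵥ y) t = x t + y t

  _-ᵥ_ : ∀ {d} → ℝ^ d → ℝ^ d → ℝ^ d
  (x -ᵥ y) t = x t - y t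

  -ᵥ_ : ∀ {d} → ℝ^ d → ℝ^ d
  (-ᵥ x) t = - x t

  _·ᵥ_ : ∀ {d} → Carrier → ℝ^ d → ℝ^ d
  (a ·ᵥ x) t = a * x t

  0ᵥ : ∀ {d} → ℝ^ d
  0ᵥ _ = 0#

  combination : ∀ {d n} → Vector Carrier n → Vector (ℝ^ d) n → ℝ^ d
  combination c b t = sum (λ s → c s * b s t)

  whole : ∀ {d} → Subset d
  whole _ = ⊤

  record IsLinearSubspace {d} (E : Subset d) : Set where
    field
      respects : E Respects _≋_
      zero∈    : 0ᵥ ∈ E
      +-closed : ∀ {x y} → x ∈ E → y ∈ E → x +ᵥ y ∈ E
      ·-closed : ∀ a {x} → x ∈ E → a ·ᵥ x ∈ E

  LinearlyIndependent : ∀ {d n} → Vector (ℝ^ d) n → Set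
  LinearlyIndependent b = ∀ c → combination c b ≋ 0ᵥ → ∀ s → c s ≈ 0#

  HasDimension : ∀ {d} → Subset d → ℕ → Set
  HasDimension {d} E n =
    Σ[ b ∈ Vector (ℝ^ d) n ]
      (∀ s → b s ∈ E)
      × LinearlyIndependent b
      × (∀ x → x ∈ E → ∃[ c ] (x ≋ combination c b))

  IsDirectSum : ∀ {d} → Subset d → Subset d → Set
  IsDirectSum V W =
    (∀ x → ∃[ v ] ∃[ w ] (v ∈ V × w ∈ W × x ≋ v +ᵥ w))
    × (∀ x → x ∈ V → x ∈ W → x ≋ 0ᵥ)

  IsAffineSubspace : ∀ {d} → Subset d → ℕ → Subset d → Set₁
  IsAffineSubspace {d} E n U =
    U ⊆ E
    × ∃[ p ] Σ[ F ∈ Subset d ]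
        (IsLinearSubspace F × HasDimension F n × U ≐ (λ x → x -ᵥ p ∈ F))

  -- Distance less than ε in the sup norm, which induces the usual topology.
  Near : ∀ {d} → Carrier → ℝ^ d → ℝ^ d → Set
  Near ε x y = ∀ t → (x t - y t < ε) × (y t - x t < ε)

  IsOpen : ∀ {d} → Subset d → Set
  IsOpen O = ∀ x → x ∈ O → ∃[ ε ] (0# < ε × (∀ y → Near ε x y → y ∈ O))

  IsCompact : ∀ {d} → Subset d → Set₁
  IsCompact {d} C =
    (I : Set) (O : I → Subset d) → (∀ i → IsOpen (O i)) →
    (∀ x → x ∈ C → ∃[ i ] (x ∈ O i)) →
    Σ[ is ∈ List I ] (∀ x → x ∈ C → Any (λ i → x ∈ O i) is)

  IsConvex : ∀ {d} → Subset d → Set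
  IsConvex C = ∀ x y a → x ∈ C → y ∈ C → 0# ≤ a → a ≤ 1# →
               a ·ᵥ x +ᵥ (1# - a) ·ᵥ y ∈ C

  LinearHull : ∀ {d} → Subset d → Subset d
  LinearHull {d} A x =
    ∃[ n ] Σ[ p ∈ Vector (ℝ^ d) n ] ∃[ c ]
      ((∀ s → p s ∈ A) × x ≋ combination c p)

  AffineHull : ∀ {d} → Subset d → Subset d
  AffineHull {d} A x =
    ∃[ n ] Σ[ p ∈ Vector (ℝ^ d) n ] ∃[ c ]
      ((∀ s → p s ∈ A) × sum c ≈ 1# × x ≋ combination c p)

  -- Full-dimensionality is relative to the subspace E: aff C = E.
  record IsConvexBody {d} (E C : Subset d) : Set₁ where
    field
      respects        : C Respects _≋_
      ⊆-space         : C ⊆ E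
      compact         : IsCompact C
      convex          : IsConvex C
      fullDimensional : E ⊆ AffineHull C

  -- For a discrete subgroup, full rank in E means that it spans E over ℝ.
  record IsLattice {d} (E Γ : Subset d) : Set where
    field
      respects   : Γ Respects _≋_
      ⊆-space    : Γ ⊆ E
      zero∈      : 0ᵥ ∈ Γ
      +-closed   : ∀ {x y} → x ∈ Γ → y ∈ Γ → x +ᵥ y ∈ Γ
      neg-closed : ∀ {x} → x ∈ Γ → -ᵥ x ∈ Γ
      discrete   : ∀ x → x ∈ Γ →
                   ∃[ ε ] (0# < ε × (∀ y → y ∈ Γ → Near ε x y → x ≋ y))
      fullRank   : E ⊆ LinearHull Γ

  infixl 7 _·ˢ_
  infixl 6 _+ˢ_ _⊕_

  _·ˢ_ : ∀ {d} → Carrier → Subset d → Subset d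
  (a ·ˢ A) z = ∃[ x ] (x ∈ A × z ≋ a ·ᵥ x)

  _+ˢ_ : ∀ {d} → Subset d → Subset d → Subset d
  (A +ˢ B) z = ∃[ x ] ∃[ y ] (x ∈ A × y ∈ B × z ≋ x +ᵥ y)

  _⊕_ : ∀ {d} → Subset d → Subset d → Subset d
  (K ⊕ L) z =
    ∃[ x ] ∃[ y ] ∃[ a ]
      (x ∈ K × y ∈ L × 0# ≤ a × a ≤ 1# × z ≋ a ·ᵥ x +ᵥ (1# - a) ·ᵥ y)

  CoveringFactor : ∀ {d} → Subset d → ℕ → Subset d → Subset d → ℕ →
                   Pred Carrier (lsuc 0ℓ)
  CoveringFactor E k C Γ i μ =
    0# ≤ μ
    × (∀ U → IsAffineSubspace E (k ∸ i) U → Satisfiable ((μ ·ˢ C +ˢ Γ) ∩ U))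

  -- IsCoveringMinimum E k C Γ i m  means  μ_i(C,Γ) = m, taken in the linear
  -- subspace E of dimension k; it is meaningful for i ≤ k only.  A relation is
  -- used because μ_i is defined as a minimum, not as an infimum.  The case
  -- i = 0 is the convention μ_0 = 0.
  IsCoveringMinimum : ∀ {d} → Subset d → ℕ → Subset d → Subset d → ℕ →
                      Pred Carrier (lsuc 0ℓ)
  IsCoveringMinimum E k C Γ zero    m = Lift (lsuc 0ℓ) (m ≈ 0#)
  IsCoveringMinimum E k C Γ (suc i) m = IsMinimum (CoveringFactor E k C Γ (suc i)) m

{-# OPTIONS --safe #-}
module Submission where

-- Let U = p + F be an affine subspace of dimension d − i, let G be the projection
-- of F to V along W, and H = F ∩ W.  If dim G = ℓ − j then, by rank–nullity,
-- dim H = (d − ℓ) − (i − j).  A point of μ_j(K)K + Λ on the projection of U singles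
-- out a fibre of U, a translate of H, which in turn meets μ_{i−j}(L)L + Γ; the sum
-- of the two points lies in U and in (μ_j(K) + μ_{i−j}(L))(K ⊕ L) + Λ + Γ.
-- Conversely, if μ < μ_j(K) + μ_{i−j}(L), write μ = a + b with a < μ_j(K) and
-- b < μ_{i−j}(L), and choose flats A ⊆ V and B ⊆ W missed by aK + Λ and bL + Γ.
-- A point of A + B in μ(K ⊕ L) + Λ + Γ would make A meet τμK + Λ and B meet
-- (1 − τ)μL + Γ for some τ ∈ [0,1], but τμ ≤ a or (1 − τ)μ ≤ b.

open import Defs
open import Level using (0ℓ; Lift; lift; lower) renaming (suc to lsuc)
open import Algebra.Bundles using (CommutativeRing; RawRing)
import Algebra.Properties.CommutativeSemigroup as CommutativeSemigroup
open import Algebra.Solver.Ring.AlmostCommutativeRing using (AlmostCommutativeRing; fromCommutativeRing; -raw-almostCommutative⟶; _-Raw-AlmostCommutative⟶_; Induced-equivalence)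
import Algebra.Properties.Semiring.Mult
import Algebra.Properties.Semiring.Sum
import Algebra.Solver.Ring
open import Axiom.ExcludedMiddle using (ExcludedMiddle)
open import Data.Empty using (⊥)
open import Data.Fin.Base using (Fin; zero; suc; _↑ˡ_; _↑ʳ_; punchIn)
open import Data.Maybe.Base using (just; nothing)
open import Data.Nat.Base as ℕ using (ℕ; zero; suc; _∸_)
import Data.Nat.Properties as ℕ
open import Data.Product using (∃-syntax; Σ-syntax; _×_; _,_; proj₁; proj₂)
open import Data.Sum.Base using (_⊎_; inj₁; inj₂)
open import Data.Vec.Functional using (Vector; _∷_; _++_; tail; insertAt)
open import Data.Vec.Functional.Properties using (insertAt-lookup; insertAt-punchIn; lookup-++ˡ; lookup-++ʳ)
open import Function.Base using (_∘_)
open import Relation.Binary.Definitions using (WeaklyDecidable)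
import Relation.Binary.PropositionalEquality as ≡
open import Relation.Binary.PropositionalEquality.Core using (_≡_)
open import Relation.Binary.Structures using (IsTotalOrder)
open import Relation.Nullary using (¬_; Dec; yes; no; contradiction)
open import Relation.Nullary.Decidable using (map′; decidable-stable)
open import Relation.Unary using (_∈_; _⊆_; _≐_; _∩_; Satisfiable)

-- A ring solver with integer coefficients.

-- An integer coefficient m − n is represented by the pair (m , n), so that
-- identities with cancellation are decided in a ring with undecidable equality.
module RingSolver (R : CommutativeRing 0ℓ 0ℓ) where

  open CommutativeRing R hiding (zero)
  open Algebra.Properties.Semiring.Mult semiring using (×-homo-+; ×1-homo-*; ×-congˡ)
    renaming (_×_ to _×̇_)

  open import Algebra.Properties.AbelianGroup +-abelianGroup using (⁻¹-anti-homo‿-; ε⁻¹≈ε)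
  open import Algebra.Properties.Ring ring using (-‿involutive; -‿distribˡ-*; -‿distribʳ-*; -‿+-comm)
  open import Relation.Binary.Reasoning.Setoid setoid

  private
    acr : AlmostCommutativeRing 0ℓ 0ℓ
    acr = fromCommutativeRing R

    module S = Algebra.Solver.Ring (AlmostCommutativeRing.rawRing acr) acr
                 (-raw-almostCommutative⟶ acr) (λ _ _ → nothing)

    -- Cancelling the common part leaves one component zero, so a coefficient equal to 0 or 1
    -- appears literally as `(0 , 0)` or `(1 , 0)`.
    reduce : ℕ → ℕ → ℕ × ℕ
    reduce (suc m) (suc n) = reduce m n
    reduce m       n       = m , n

    difference : RawRing 0ℓ 0ℓ
    difference = record
      { Carrier = ℕ × ℕ
      ; _≈_     = _≡_
      ; _+_     = λ (a , b) (c , d) → reduce (a ℕ.+ c) (b ℕ.+ d)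
      ; _*_     = λ (a , b) (c , d) → reduce (a ℕ.* c ℕ.+ b ℕ.* d) (a ℕ.* d ℕ.+ b ℕ.* c)
      ; -_      = λ (a , b) → b , a
      ; 0#      = 0 , 0
      ; 1#      = 1 , 0
      }

    value : ℕ × ℕ → Carrier
    value (m , n) = m ×̇ 1# - n ×̇ 1#

    -- The first two clauses make the constants 0# and 1# of a goal
    -- definitionally equal to the interpretation of coefficients.
    ⟦_⟧ : ℕ × ℕ → Carrier
    ⟦ 0 , 0 ⟧ = 0#
    ⟦ 1 , 0 ⟧ = 1#
    ⟦ m , n ⟧ = value (m , n)

    ⟦⟧≈value : ∀ p → ⟦ p ⟧ ≈ value p
    ⟦⟧≈value (0 , 0) = sym (-‿inverseʳ 0#)
    ⟦⟧≈value (1 , 0) = begin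
      1#               ≈⟨ +-identityʳ 1# ⟨
      1# + 0#          ≈⟨ +-identityʳ (1# + 0#) ⟨
      1# + 0# + 0#     ≈⟨ +-congˡ ε⁻¹≈ε ⟨
      1# + 0# - 0#     ∎
    ⟦⟧≈value (0 , suc n)       = refl
    ⟦⟧≈value (1 , suc n)       = refl
    ⟦⟧≈value (suc (suc m) , n) = refl

    cancel : ∀ a b c d → a + d ≈ c + b → a - b ≈ c - d
    cancel a b c d eq = begin
      -- The solver `S` never decides equality of coefficients and so cannot cancel; `d - d` and
      -- `b - b` are inserted and removed by hand.
      a - b                 ≈⟨ +-identityʳ _ ⟨
      a - b + 0#            ≈⟨ +-congˡ (-‿inverseʳ d) ⟨
      a - b + (d - d)       ≈⟨ S.solve 3 (λ a b d → (a S.:- b) S.:+ (d S.:- d) S.:= (a S.:+ d) S.:+ (S.:- b S.:- d)) refl a b d ⟩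
      a + d + (- b - d)     ≈⟨ +-congʳ eq ⟩
      c + b + (- b - d)     ≈⟨ S.solve 3 (λ c b d → (c S.:+ b) S.:+ (S.:- b S.:- d) S.:= (c S.:- d) S.:+ (b S.:- b)) refl c b d ⟩
      c - d + (b - b)       ≈⟨ +-congˡ (-‿inverseʳ b) ⟩
      c - d + 0#            ≈⟨ +-identityʳ _ ⟩
      c - d                 ∎

    ⟦reduce⟧ : ∀ m n → ⟦ reduce m n ⟧ ≈ value (m , n)
    ⟦reduce⟧ (suc m) (suc n) = trans (⟦reduce⟧ m n) (cancel _ _ _ _
      (S.solve 3 (λ x y z → x S.:+ (z S.:+ y) S.:= (z S.:+ x) S.:+ y) refl (m ×̇ 1#) (n ×̇ 1#) 1#))
    ⟦reduce⟧ zero    n    = ⟦⟧≈value (zero , n)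
    ⟦reduce⟧ (suc m) zero = ⟦⟧≈value (suc m , zero)

    ×1-homo-*+* : ∀ a b c d → (a ℕ.* b ℕ.+ c ℕ.* d) ×̇ 1# ≈ (a ×̇ 1#) * (b ×̇ 1#) + (c ×̇ 1#) * (d ×̇ 1#)
    ×1-homo-*+* a b c d = trans (×-homo-+ 1# (a ℕ.* b) (c ℕ.* d)) (+-cong (×1-homo-* a b) (×1-homo-* c d))

    neg-*-neg : ∀ x y → x * y ≈ - x * - y
    neg-*-neg x y = begin
      x * y        ≈⟨ -‿involutive _ ⟨
      - - (x * y)  ≈⟨ -‿cong (-‿distribʳ-* x y) ⟩
      - (x * - y)  ≈⟨ -‿distribˡ-* x (- y) ⟩
      - x * - y    ∎

    neg-*+* : ∀ a d b c → - (a * d + b * c) ≈ a * - d + - b * c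
    neg-*+* a d b c = trans (sym (-‿+-comm (a * d) (b * c))) (+-cong (-‿distribʳ-* a d) (-‿distribˡ-* b c))

    morphism : difference -Raw-AlmostCommutative⟶ acr
    morphism = record
      { ⟦_⟧    = ⟦_⟧
      ; +-homo = λ p@(a , b) q@(c , d) → trans (⟦reduce⟧ (a ℕ.+ c) _) (trans
          (+-cong (×-homo-+ 1# a c) (-‿cong (×-homo-+ 1# b d)))
          (trans (S.solve 4 (λ a b c d → (a S.:+ c) S.:- (b S.:+ d) S.:= (a S.:- b) S.:+ (c S.:- d))
                    refl (a ×̇ 1#) (b ×̇ 1#) (c ×̇ 1#) (d ×̇ 1#))
            (+-cong (sym (⟦⟧≈value p)) (sym (⟦⟧≈value q)))))
      ; *-homo = λ p@(a , b) q@(c , d) → trans (⟦reduce⟧ (a ℕ.* c ℕ.+ b ℕ.* d) _) (trans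
          (+-cong (×1-homo-*+* a c b d) (-‿cong (×1-homo-*+* a d b c)))
          (trans (+-cong (+-congˡ (neg-*-neg (b ×̇ 1#) (d ×̇ 1#)))
                         (neg-*+* (a ×̇ 1#) (d ×̇ 1#) (b ×̇ 1#) (c ×̇ 1#)))
            (trans (S.solve 4 (λ a b c d → (a S.:* c S.:+ b S.:* d) S.:+ (a S.:* d S.:+ b S.:* c)
                                           S.:= (a S.:+ b) S.:* (c S.:+ d))
                      refl (a ×̇ 1#) (- (b ×̇ 1#)) (c ×̇ 1#) (- (d ×̇ 1#)))
              (*-cong (sym (⟦⟧≈value p)) (sym (⟦⟧≈value q))))))
      ; -‿homo = λ p@(a , b) → trans (⟦⟧≈value (b , a)) (trans
          (sym (⁻¹-anti-homo‿- (a ×̇ 1#) (b ×̇ 1#)))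
          (-‿cong (sym (⟦⟧≈value p))))
      ; 0-homo = refl
      ; 1-homo = refl
      }

    _≟_ : WeaklyDecidable (Induced-equivalence morphism)
    (a , b) ≟ (c , d) with (a ℕ.+ d) ℕ.≟ (c ℕ.+ b)
    ... | no  _  = nothing
    ... | yes eq = just (trans (⟦⟧≈value (a , b)) (trans
            (cancel _ _ _ _ (trans (sym (×-homo-+ 1# a d)) (trans (×-congˡ eq) (×-homo-+ 1# c b))))
            (sym (⟦⟧≈value (c , d)))))

  open Algebra.Solver.Ring difference acr morphism _≟_ public
    using (solve; Polynomial; con; _:+_; _:*_; _:-_; :-_; _:=_)

  :0 :1 : ∀ {n} → Polynomial n
  :0 = con (0 , 0)
  :1 = con (1 , 0)

-- Inequalities in an ordered field.

module OrderedField (em : ExcludedMiddle 0ℓ) (ℝ : RealNumbers) where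

  open RealNumbers ℝ
  open CommutativeRing commutativeRing
    using (refl; trans; +-congˡ; +-congʳ; *-congˡ; -‿cong; +-identityˡ; zeroʳ; -‿inverseʳ)
  open IsTotalOrder isTotalOrder
    using (total; antisym; ≤-respʳ-≈; ≤-respˡ-≈) renaming (trans to ≤-trans; reflexive to ≤-reflexive)
  open RingSolver commutativeRing

  x≤y⇒0≤y-x : ∀ {x y} → x ≤ y → 0# ≤ y - x
  x≤y⇒0≤y-x {x} x≤y = ≤-respˡ-≈ (-‿inverseʳ x) (+-monoˡ-≤ (- x) x≤y)

  0≤y-x⇒x≤y : ∀ {x y} → 0# ≤ y - x → x ≤ y
  0≤y-x⇒x≤y {x} {y} 0≤y-x = ≤-respˡ-≈ (+-identityˡ x)
    (≤-respʳ-≈ (solve 2 (λ x y → (y :- x) :+ x := y) refl x y) (+-monoˡ-≤ x 0≤y-x))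

  0≤x+y : ∀ {x y} → 0# ≤ x → 0# ≤ y → 0# ≤ x + y
  0≤x+y {x} {y} 0≤x 0≤y = ≤-trans 0≤y (≤-respˡ-≈ (+-identityˡ y) (+-monoˡ-≤ y 0≤x))

  x≤0⇒0≤-x : ∀ {x} → x ≤ 0# → 0# ≤ - x
  x≤0⇒0≤-x {x} x≤0 = ≤-respʳ-≈ (+-identityˡ (- x)) (x≤y⇒0≤y-x x≤0)

  0≤1 : 0# ≤ 1#
  0≤1 with total 0# 1#
  ... | inj₁ 0≤1 = 0≤1
  ... | inj₂ 1≤0 = ≤-respʳ-≈ (solve 0 (:- :1 :* :- :1 := :1) refl) (*-nonNegative 0≤-1 0≤-1)
    where
    0≤-1 : 0# ≤ - 1#
    0≤-1 = x≤0⇒0≤-x 1≤0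

  1≰0 : ¬ (1# ≤ 0#)
  1≰0 1≤0 = 0≉1 (antisym 0≤1 1≤0)

  -- If `y ≤ 0#`, then `x * - y` is non-negative, yet it equals minus one.
  0≤-inverse : ∀ {x y} → 0# ≤ x → x * y ≈ 1# → 0# ≤ y
  0≤-inverse {x} {y} 0≤x xy≈1 with total 0# y
  ... | inj₁ 0≤y = 0≤y
  ... | inj₂ y≤0 = contradiction (0≤y-x⇒x≤y (≤-respʳ-≈ x*-y≈0-1 (*-nonNegative 0≤x (x≤0⇒0≤-x y≤0)))) 1≰0
    where
    x*-y≈0-1 : x * - y ≈ 0# - 1#
    x*-y≈0-1 = trans (solve 2 (λ x y → x :* :- y := :0 :- x :* y) refl x y)
                     (+-congˡ (-‿cong xy≈1))

  1+1≉0 : ¬ (1# + 1# ≈ 0#)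
  1+1≉0 2≈0 = 1≰0 (≤-respʳ-≈ 2≈0 (0≤y-x⇒x≤y (≤-respʳ-≈ (solve 1 (λ x → x := x :+ x :- x) refl 1#) 0≤1)))

  half : ∃[ h ] (h + h ≈ 1#)
  half = h , trans (solve 1 (λ h → h :+ h := (:1 :+ :1) :* h) refl h) (proj₂ (inverse (1# + 1#) 1+1≉0))
    where h = proj₁ (inverse (1# + 1#) 1+1≉0)

  -- The quotient `u / v`, by which a dilate with factor `u` is found inside the dilate with factor
  -- `v`.
  ratio : ∀ {u v} → 0# ≤ u → u ≤ v → ∃[ a ] (0# ≤ a × a ≤ 1# × v * a ≈ u)
  ratio {u} {v} 0≤u u≤v with em {v ≈ 0#}
  -- When `v` vanishes, so does `u`, being squeezed between 0 and `v`; any factor in the unit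
  -- interval would serve.
  ... | yes v≈0 = 0# , ≤-reflexive refl , 0≤1 ,
                  trans (zeroʳ v) (antisym 0≤u (≤-respʳ-≈ v≈0 u≤v))
  ... | no  v≉0 with inverse v v≉0
  ...   | w , vw≈1 = u * w , *-nonNegative 0≤u 0≤w ,
                     0≤y-x⇒x≤y (≤-respʳ-≈ [v-u]w≈1-uw (*-nonNegative (x≤y⇒0≤y-x u≤v) 0≤w)) ,
                     trans (solve 3 (λ u v w → v :* (u :* w) := u :* (v :* w)) refl u v w)
                       (trans (*-congˡ vw≈1) (solve 1 (λ u → u :* :1 := u) refl u))
    where
    0≤w : 0# ≤ w
    0≤w = 0≤-inverse (≤-trans 0≤u u≤v) vw≈1
    [v-u]w≈1-uw : (v - u) * w ≈ 1# - u * w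
    [v-u]w≈1-uw = trans (solve 3 (λ u v w → (v :- u) :* w := v :* w :- u :* w) refl u v w) (+-congʳ vw≈1)

  -- Induction on the range. Excluded middle decides whether earlier indices satisfy `P`, and then
  -- whether the last index does so with a larger value than the maximum found so far.
  maximiser : (P : ℕ → Set) (f : ℕ → Carrier) (n : ℕ) → ∃[ j ] (j ℕ.≤ n × P j) →
              ∃[ j ] (P j × (∀ k → k ℕ.≤ n → P k → f k ≤ f j))
  maximiser P f zero (zero , _ , p0) = 0 , p0 , λ { zero _ _ → ≤-reflexive refl }
  maximiser P f (suc n) (j , j≤1+n , pj) with em {∃[ k ] (k ℕ.≤ n × P k)}
  ... | no none = j , pj , only-j
    where
    last : ∀ k → k ℕ.≤ suc n → P k → k ≡ suc n
    last k k≤1+n pk with k ℕ.≤? n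
    ... | yes k≤n = contradiction (k , k≤n , pk) none
    ... | no  k≰n = ℕ.≤-antisym k≤1+n (ℕ.≰⇒> k≰n)
    only-j : ∀ k → k ℕ.≤ suc n → P k → f k ≤ f j
    only-j k k≤ pk rewrite last k k≤ pk | last j j≤1+n pj = ≤-reflexive refl
  ... | yes some with maximiser P f n some
  ...   | b , pb , max with em {P (suc n) × ¬ (f (suc n) ≤ f b)}
  ...     | yes (p1+n , f≰) = suc n , p1+n , bound
    where
    fb≤ : f b ≤ f (suc n)
    fb≤ with total (f b) (f (suc n))
    ... | inj₁ le = le
    ... | inj₂ ge = contradiction ge f≰
    bound : ∀ k → k ℕ.≤ suc n → P k → f k ≤ f (suc n)
    bound k k≤1+n pk with ℕ.m≤n⇒m<n∨m≡n k≤1+n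
    ... | inj₁ (ℕ.s≤s k≤n) = ≤-trans (max k k≤n pk) fb≤
    ... | inj₂ ≡.refl      = ≤-reflexive refl
  ...     | no never = b , pb , bound
    where
    bound : ∀ k → k ℕ.≤ suc n → P k → f k ≤ f b
    bound k k≤1+n pk with ℕ.m≤n⇒m<n∨m≡n k≤1+n
    ... | inj₁ (ℕ.s≤s k≤n) = max k k≤n pk
    ... | inj₂ ≡.refl      = decidable-stable em λ f≰ → never (pk , f≰)

-- Linear combinations and linear dependence.

module LinearAlgebra (em : ExcludedMiddle 0ℓ) (ℝ : RealNumbers) where

  open RealNumbers ℝ
  open Geometry ℝ
  open CommutativeRing commutativeRing
    using (refl; sym; trans; reflexive; +-cong; +-congˡ; +-congʳ; *-cong; *-congˡ; *-congʳ; -‿cong;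
           +-identityˡ; +-identityʳ; +-assoc; zeroˡ; zeroʳ; semiring)
  open RingSolver commutativeRing
  open Algebra.Properties.Semiring.Sum semiring
    using (sum; sum-cong-≋; sum-replicate-zero; sum-remove; ∑-distrib-+; ∑-comm; *-distribˡ-sum; *-distribʳ-sum)
  open import Data.Vec.Functional.Relation.Binary.Equality.Setoid setoid
    using (_≋_; ≋-refl; ≋-sym; ≋-trans)
  open import Relation.Binary.Reasoning.Setoid setoid

  private
    variable
      d m n r t : ℕ
      E E′ W : Subset d

  +ᵥ-cong : {x x′ y y′ : ℝ^ d} → x ≋ x′ → y ≋ y′ → x +ᵥ y ≋ x′ +ᵥ y′
  +ᵥ-cong p q t = +-cong (p t) (q t)

  sum-zero : (f : Vector Carrier n) → (∀ s → f s ≈ 0#) → sum f ≈ 0#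
  sum-zero {n} f f≈0 = trans (sum-cong-≋ f≈0) (sum-replicate-zero n)

  sum-↑ : ∀ m (f : Vector Carrier (m ℕ.+ n)) → sum f ≈ sum (f ∘ (_↑ˡ n)) + sum (f ∘ (m ↑ʳ_))
  sum-↑ zero    f = sym (+-identityˡ _)
  sum-↑ (suc m) f = trans (+-congˡ (sum-↑ m (tail f))) (sym (+-assoc _ _ _))

  combination-cong : {c c′ : Vector Carrier n} {b b′ : Vector (ℝ^ d) n} →
                     c ≋ c′ → (∀ s → b s ≋ b′ s) → combination c b ≋ combination c′ b′
  combination-cong c≈ b≈ t = sum-cong-≋ (λ s → *-cong (c≈ s) (b≈ s t))

  combination-+ˡ : (c c′ : Vector Carrier n) (b : Vector (ℝ^ d) n) →
                   combination (c +ᵥ c′) b ≋ combination c b +ᵥ combination c′ b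
  combination-+ˡ c c′ b t = trans
    (sum-cong-≋ (λ s → solve 3 (λ x y z → (x :+ y) :* z := x :* z :+ y :* z) refl (c s) (c′ s) (b s t)))
    (∑-distrib-+ (λ s → c s * b s t) (λ s → c′ s * b s t))

  combination-+ʳ : (c : Vector Carrier n) (b b′ : Vector (ℝ^ d) n) →
                   combination c (λ s → b s +ᵥ b′ s) ≋ combination c b +ᵥ combination c b′
  combination-+ʳ c b b′ t = trans
    (sum-cong-≋ (λ s → solve 3 (λ x y z → x :* (y :+ z) := x :* y :+ x :* z) refl (c s) (b s t) (b′ s t)))
    (∑-distrib-+ (λ s → c s * b s t) (λ s → c s * b′ s t))

  combination-· : ∀ a (c : Vector Carrier n) (b : Vector (ℝ^ d) n) →
                  combination (a ·ᵥ c) b ≋ a ·ᵥ combination c b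
  combination-· a c b t = trans
    (sum-cong-≋ (λ s → solve 3 (λ x y z → (x :* y) :* z := x :* (y :* z)) refl a (c s) (b s t)))
    (sym (*-distribˡ-sum a (λ s → c s * b s t)))

  combination-zero : (c : Vector Carrier n) (b : Vector (ℝ^ d) n) →
                     c ≋ 0ᵥ → combination c b ≋ 0ᵥ
  combination-zero c b c≈0 t = sum-zero _ (λ s → trans (*-congʳ (c≈0 s)) (zeroˡ _))

  combination-++ : ∀ (c : Vector Carrier (m ℕ.+ n)) (b : Vector (ℝ^ d) m) (b′ : Vector (ℝ^ d) n) →
                   combination c (b ++ b′) ≋ combination (c ∘ (_↑ˡ n)) b +ᵥ combination (c ∘ (m ↑ʳ_)) b′
  combination-++ {m} {n} c b b′ t = trans (sum-↑ m (λ s → c s * (b ++ b′) s t))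
    (+-cong (sum-cong-≋ {m} λ s → *-congˡ (reflexive (≡.cong (λ x → x t) (lookup-++ˡ b b′ s))))
            (sum-cong-≋ {n} λ s → *-congˡ (reflexive (≡.cong (λ x → x t) (lookup-++ʳ b b′ s)))))

  -- The coefficients with respect to `b` are the product of the row `c` with the matrix `C`; the
  -- proof exchanges the two sums.
  combination-combination : (c : Vector Carrier m) (C : Vector (ℝ^ n) m) (b : Vector (ℝ^ d) n) →
    combination c (λ s → combination (C s) b) ≋ combination (combination c C) b
  combination-combination {m} {n} c C b t = begin
    sum (λ s → c s * sum (λ u → C s u * b u t))
      ≈⟨ sum-cong-≋ (λ s → trans (*-distribˡ-sum (c s) (λ u → C s u * b u t))
           (sum-cong-≋ λ u → solve 3 (λ x y z → x :* (y :* z) := (x :* y) :* z) refl (c s) (C s u) (b u t))) ⟩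
    sum (λ s → sum (λ u → c s * C s u * b u t))
      ≈⟨ ∑-comm (λ s u → c s * C s u * b u t) ⟩
    sum (λ u → sum (λ s → c s * C s u * b u t))
      ≈⟨ sum-cong-≋ (λ u → sym (*-distribʳ-sum (b u t) (λ s → c s * C s u))) ⟩
    sum (λ u → sum (λ s → c s * C s u) * b u t) ∎

  -- Gaussian elimination: clear coordinate zero with a pivot and recurse.
  dependent : ∀ n {m} (a : Vector (ℝ^ n) m) → n ℕ.< m →
              ∃[ c ] (combination c a ≋ 0ᵥ × ∃[ s ] ¬ (c s ≈ 0#))
  dependent zero    a (ℕ.s≤s _) = (λ _ → 1#) , (λ ()) , zero , λ 1≈0 → 0≉1 (sym 1≈0)
  dependent (suc n) {suc m} a (ℕ.s≤s n<m) with em {∃[ p ] ¬ (a p zero ≈ 0#)}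
  -- Without a pivot, coordinate zero vanishes throughout and is dropped; all `suc m` vectors are
  -- kept.
  ... | no none = c , c-relation , c-nonzero
    where
    rec = dependent n (λ s → tail (a s)) (ℕ.m<n⇒m<1+n n<m)
    c = proj₁ rec
    c-nonzero = proj₂ (proj₂ rec)
    c-relation : combination c a ≋ 0ᵥ
    c-relation zero    = sum-zero _ λ s →
      trans (*-congˡ (decidable-stable em λ a≉0 → none (s , a≉0))) (zeroʳ (c s))
    c-relation (suc t) = proj₁ (proj₂ rec) t
  ... | yes (p , pivot≉0) = c , c-relation , punchIn p s₀ , c-nonzero
    where
    β = proj₁ (inverse (a p zero) pivot≉0)
    rest : Vector (ℝ^ (suc n)) m
    rest s = a (punchIn p s)
    cleared : Vector (ℝ^ (suc n)) m
    cleared s t = rest s t - rest s zero * β * a p t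
    rec = dependent n (λ s → tail (cleared s)) n<m
    c′ = proj₁ rec
    s₀ = proj₁ (proj₂ (proj₂ rec))
    -- The multiples of the pivot vector subtracted in `cleared` add up to `ρ` times that vector, so
    -- `- ρ` is its coefficient in the original relation.
    ρ = sum (λ s → c′ s * (rest s zero * β))
    c : Vector Carrier (suc m)
    c = insertAt c′ p (- ρ)
    c-nonzero : ¬ (c (punchIn p s₀) ≈ 0#)
    c-nonzero c≈0 = proj₂ (proj₂ (proj₂ rec)) (≡.subst (_≈ 0#) (insertAt-punchIn c′ p (- ρ) s₀) c≈0)
    cleared-relation : combination c′ cleared ≋ 0ᵥ
    cleared-relation zero    = sum-zero _ λ s → begin
      c′ s * (rest s zero - rest s zero * β * a p zero)
        ≈⟨ solve 4 (λ x y z w → x :* (y :- y :* z :* w) := x :* (y :- y :* (w :* z))) refl (c′ s) (rest s zero) β (a p zero) ⟩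
      c′ s * (rest s zero - rest s zero * (a p zero * β))
        ≈⟨ *-congˡ (+-congˡ (-‿cong (*-congˡ (proj₂ (inverse (a p zero) pivot≉0))))) ⟩
      c′ s * (rest s zero - rest s zero * 1#)
        ≈⟨ solve 2 (λ x y → x :* (y :- y :* :1) := :0) refl (c′ s) (rest s zero) ⟩
      0# ∎
    cleared-relation (suc t) = proj₁ (proj₂ rec) t
    c-relation : combination c a ≋ 0ᵥ
    c-relation t = begin
      sum (λ s → c s * a s t)
        ≈⟨ sum-remove {i = p} (λ s → c s * a s t) ⟩
      c p * a p t + sum (λ s → c (punchIn p s) * rest s t)
        ≡⟨ ≡.cong (λ x → x * a p t + sum (λ s → c (punchIn p s) * rest s t)) (insertAt-lookup c′ p (- ρ)) ⟩
      - ρ * a p t + sum (λ s → c (punchIn p s) * rest s t)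
        ≈⟨ +-cong (solve 2 (λ x y → :- x :* y := x :* :- y) refl ρ (a p t))
                  (sum-cong-≋ λ s → *-congʳ (reflexive (insertAt-punchIn c′ p (- ρ) s))) ⟩
      ρ * - a p t + sum (λ s → c′ s * rest s t)
        ≈⟨ +-congʳ (*-distribʳ-sum (- a p t) (λ s → c′ s * (rest s zero * β))) ⟩
      sum (λ s → c′ s * (rest s zero * β) * - a p t) + sum (λ s → c′ s * rest s t)
        ≈⟨ sym (∑-distrib-+ (λ s → c′ s * (rest s zero * β) * - a p t) (λ s → c′ s * rest s t)) ⟩
      sum (λ s → c′ s * (rest s zero * β) * - a p t + c′ s * rest s t)
        ≈⟨ sum-cong-≋ (λ s → solve 4 (λ x y z w → x :* y :* :- z :+ x :* w := x :* (w :- y :* z)) refl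
             (c′ s) (rest s zero * β) (a p t) (rest s t)) ⟩
      combination c′ cleared t
        ≈⟨ cleared-relation t ⟩
      0# ∎

  -- Span, bases and dimension.

  Span : Vector (ℝ^ d) n → Subset d
  Span b x = ∃[ c ] (x ≋ combination c b)

  -- The coefficient vectors of `b′` lie in `ℝ^ n`. Were `m` larger than `n`, they would be
  -- dependent, and the same relation would hold among the vectors of `b′`.
  independent-in-span⇒≤ : (b : Vector (ℝ^ d) n) (b′ : Vector (ℝ^ d) m) → LinearlyIndependent b′ →
                          (∀ s → b′ s ∈ Span b) → m ℕ.≤ n
  independent-in-span⇒≤ {n = n} {m = m} b b′ indep b′∈ with m ℕ.≤? n
  ... | yes m≤n = m≤n
  ... | no  m≰n with dependent n (λ s → proj₁ (b′∈ s)) (ℕ.≰⇒> m≰n)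
  ...   | c , relation , s , c≉0 = contradiction (indep c b′-relation s) c≉0
    where
    b′-relation : combination c b′ ≋ 0ᵥ
    b′-relation = ≋-trans (combination-cong {c = c} (λ _ → refl) (λ s → proj₂ (b′∈ s)))
      (≋-trans (combination-combination c _ b) (combination-zero _ b relation))

  independent⇒≤ : (b : Vector (ℝ^ d) n) → LinearlyIndependent b → n ℕ.≤ d
  independent⇒≤ {d} {n} b indep with n ℕ.≤? d
  ... | yes n≤d = n≤d
  ... | no  n≰d with dependent d b (ℕ.≰⇒> n≰d)
  ...   | c , relation , s , c≉0 = contradiction (indep c relation s) c≉0

  module Subspace {d} {E : Subset d} (lin : IsLinearSubspace E) where
    open IsLinearSubspace lin public

    minus-closed : ∀ {x y} → x ∈ E → y ∈ E → x -ᵥ y ∈ E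
    minus-closed {x} {y} x∈ y∈ = respects
      (λ t → solve 2 (λ a b → a :+ :- :1 :* b := a :- b) refl (x t) (y t))
      (+-closed x∈ (·-closed (- 1#) y∈))

    combination-closed : ∀ {n} (c : Vector Carrier n) (b : Vector (ℝ^ d) n) →
                         (∀ s → b s ∈ E) → combination c b ∈ E
    combination-closed {zero}  c b b∈ = zero∈
    combination-closed {suc n} c b b∈ =
      +-closed (·-closed (c zero) (b∈ zero)) (combination-closed (tail c) (tail b) (b∈ ∘ suc))

  span-isLinearSubspace : (b : Vector (ℝ^ d) n) → IsLinearSubspace (Span b)
  span-isLinearSubspace b = record
    { respects = λ x≋y (c , x≋) → c , ≋-trans (≋-sym x≋y) x≋
    ; zero∈    = (λ _ → 0#) , ≋-sym (combination-zero _ b (λ _ → refl))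
    ; +-closed = λ (c , x≋) (c′ , y≋) → c +ᵥ c′ , ≋-trans (+ᵥ-cong x≋ y≋) (≋-sym (combination-+ˡ c c′ b))
    ; ·-closed = λ a (c , x≋) → a ·ᵥ c , ≋-trans (λ t → *-congˡ (x≋ t)) (≋-sym (combination-· a c b))
    }

  ∷-independent : (v : ℝ^ d) (b : Vector (ℝ^ d) n) → LinearlyIndependent b → ¬ (v ∈ Span b) →
                  LinearlyIndependent (v ∷ b)
  ∷-independent v b indep v∉ c relation = c≈0
    where
    c₀≈0 : c zero ≈ 0#
    c₀≈0 = decidable-stable em λ c₀≉0 → v∉ (v∈ (inverse (c zero) c₀≉0))
      where
      v∈ : ∃[ w ] (c zero * w ≈ 1#) → v ∈ Span b
      -- The relation is solved for `v` by dividing by its coefficient.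
      v∈ (w , c₀w≈1) = (- w) ·ᵥ tail c , λ t → begin
        v t                                     ≈⟨ solve 1 (λ v → v := :1 :* v) refl (v t) ⟩
        1# * v t                                ≈⟨ *-congʳ (sym c₀w≈1) ⟩
        c zero * w * v t                        ≈⟨ solve 4 (λ c w v s → c :* w :* v := w :* (c :* v :+ s) :+ :- w :* s) refl (c zero) w (v t) (combination (tail c) b t) ⟩
        w * (c zero * v t + combination (tail c) b t) + - w * combination (tail c) b t
                                                ≈⟨ +-congʳ (*-congˡ (relation t)) ⟩
        w * 0# + - w * combination (tail c) b t ≈⟨ +-congʳ (zeroʳ w) ⟩
        0# + - w * combination (tail c) b t     ≈⟨ +-identityˡ _ ⟩
        - w * combination (tail c) b t          ≈⟨ sym (combination-· (- w) (tail c) b t) ⟩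
        combination ((- w) ·ᵥ tail c) b t       ∎
    c≈0 : ∀ s → c s ≈ 0#
    c≈0 zero    = c₀≈0
    c≈0 (suc s) = indep (tail c) (λ t → trans (sym (trans (+-congʳ (trans (*-congʳ c₀≈0) (zeroˡ (v t)))) (+-identityˡ _))) (relation t)) s

  tail-independent : (b : Vector (ℝ^ d) (suc n)) → LinearlyIndependent b → LinearlyIndependent (tail b)
  tail-independent b indep c relation s = indep (0# ∷ c)
    (λ t → trans (+-congʳ (zeroˡ (b zero t))) (trans (+-identityˡ _) (relation t))) (suc s)

  -- An independent family in `E` is extended by vectors outside its span until none is left.
  dimension-exists : IsLinearSubspace E → ∃[ n ] HasDimension E n
  dimension-exists {d} {E} lin = extend (suc d) 0 (ℕ.+-identityʳ (suc d)) (λ ()) (λ ()) (λ _ _ ())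
    where
    extend : ∀ k n → k ℕ.+ n ≡ suc d → (b : Vector (ℝ^ d) n) → (∀ s → b s ∈ E) →
             LinearlyIndependent b → ∃[ n ] HasDimension E n
    -- The counter runs out only with `suc d` independent vectors, one more than `ℝ^ d` allows.
    extend zero    _ ≡.refl b b∈ indep = contradiction (independent⇒≤ b indep) ℕ.1+n≰n
    extend (suc k) n k+n b b∈ indep with em {∃[ v ] (v ∈ E × ¬ (v ∈ Span b))}
    ... | no  none = n , b , b∈ , indep , λ x x∈ → decidable-stable em λ x∉ → none (x , x∈ , x∉)
    ... | yes (v , v∈ , v∉) = extend k (suc n) (≡.trans (ℕ.+-suc k n) k+n) (v ∷ b)
            (λ { zero → v∈ ; (suc s) → b∈ s }) (∷-independent v b indep v∉)

  dimension-mono : E ⊆ E′ → HasDimension E m → HasDimension E′ n → m ℕ.≤ n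
  dimension-mono E⊆E′ (b , b∈ , indep , _) (b′ , _ , _ , spans) =
    independent-in-span⇒≤ b′ b indep (λ s → spans (b s) (E⊆E′ (b∈ s)))

  dimension-unique : HasDimension E m → HasDimension E n → m ≡ n
  dimension-unique dimₘ dimₙ = ℕ.≤-antisym (dimension-mono (λ x∈ → x∈) dimₘ dimₙ) (dimension-mono (λ x∈ → x∈) dimₙ dimₘ)

  dimension-resp-≐ : E ≐ E′ → HasDimension E n → HasDimension E′ n
  dimension-resp-≐ (⊆ , ⊇) (b , b∈ , indep , spans) = b , (λ s → ⊆ (b∈ s)) , indep , λ x x∈ → spans x (⊇ x∈)

  -- A vector of `E′` outside the span of a basis of `E` would extend that basis to `suc n`
  -- independent vectors in a space of dimension `n`.
  same-dimension⇒⊇ : IsLinearSubspace E → E ⊆ E′ → HasDimension E n → HasDimension E′ n → E′ ⊆ E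
  same-dimension⇒⊇ lin E⊆E′ (b , b∈ , indep , _) (b′ , _ , _ , spans) {x} x∈ with em {x ∈ Span b}
  ... | yes (c , x≋) = respects (≋-sym x≋) (combination-closed c b b∈)
    where open Subspace lin
  ... | no  x∉ = contradiction
    (independent-in-span⇒≤ b′ (x ∷ b) (∷-independent x b indep x∉)
      (λ { zero → spans x x∈ ; (suc s) → spans (b s) (E⊆E′ (b∈ s)) }))
    ℕ.1+n≰n

  -- Leading basis vectors are dropped until `n` remain; their span is the subspace.
  subspace-of-dimension : ∀ {k} → IsLinearSubspace E → HasDimension E k → n ℕ.≤ k →
                          Σ[ F ∈ Subset d ] (IsLinearSubspace F × F ⊆ E × HasDimension F n)
  subspace-of-dimension {d} {E} {n} {k} lin (b , b∈ , indep , _) n≤k =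
    shorten (k ∸ n) (≡.subst Family (≡.sym (ℕ.m∸n+n≡m n≤k)) (b , b∈ , indep))
    where
    open Subspace lin
    Family : ℕ → Set
    Family l = Σ[ b ∈ Vector (ℝ^ d) l ] ((∀ s → b s ∈ E) × LinearlyIndependent b)
    shorten : ∀ l → Family (l ℕ.+ n) → Σ[ F ∈ Subset d ] (IsLinearSubspace F × F ⊆ E × HasDimension F n)
    shorten zero (b , b∈ , indep) = Span b , span-isLinearSubspace b ,
      (λ (c , x≋) → respects (≋-sym x≋) (combination-closed c b b∈)) ,
      -- Coordinate unit vectors witness that each basis vector lies in the span.
      b , (λ s → unit s , ≋-sym (combination-unit s)) , indep , λ _ x∈ → x∈
      where
      unit : ∀ {n} → Fin n → Vector Carrier n
      unit zero    = 1# ∷ 0ᵥ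
      unit (suc s) = 0# ∷ unit s
      combination-unit : ∀ {n} {b : Vector (ℝ^ d) n} s → combination (unit s) b ≋ b s
      combination-unit {b = b} zero t = trans
        (+-congˡ (combination-zero 0ᵥ (tail b) (λ _ → refl) t))
        (solve 1 (λ x → :1 :* x :+ :0 := x) refl (b zero t))
      combination-unit {b = b} (suc s) t = trans
        (+-cong (zeroˡ (b zero t)) (combination-unit {b = tail b} s t)) (+-identityˡ _)
    shorten (suc l) (b , b∈ , indep) = shorten l (tail b , b∈ ∘ suc , tail-independent b indep)

  ↑-cases : ∀ {m n} (P : Fin (m ℕ.+ n) → Set) → (∀ s → P (s ↑ˡ n)) → (∀ s → P (m ↑ʳ s)) → ∀ s → P s
  ↑-cases {zero}  P l r s       = r s
  ↑-cases {suc m} P l r zero    = l zero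
  ↑-cases {suc m} P l r (suc s) = ↑-cases {m} (P ∘ suc) (l ∘ suc) r s

  ++-∈ : (b : Vector (ℝ^ d) m) (b′ : Vector (ℝ^ d) n) → (∀ s → b s ∈ E) → (∀ s → b′ s ∈ E) →
         ∀ s → (b ++ b′) s ∈ E
  ++-∈ {E = E} b b′ b∈ b′∈ = ↑-cases (λ s → (b ++ b′) s ∈ E)
    (λ s → ≡.subst E (≡.sym (lookup-++ˡ b b′ s)) (b∈ s))
    (λ s → ≡.subst E (≡.sym (lookup-++ʳ b b′ s)) (b′∈ s))

  -- Here `b` is independent modulo `W`. In a relation the part in `b` is minus the part in `b′`,
  -- hence in `W`, so its coefficients vanish; what remains is a relation among `b′` alone.
  ++-independent : IsLinearSubspace W → (b : Vector (ℝ^ d) m) (b′ : Vector (ℝ^ d) n) →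
                   (∀ c → combination c b ∈ W → ∀ s → c s ≈ 0#) →
                   (∀ s → b′ s ∈ W) → LinearlyIndependent b′ → LinearlyIndependent (b ++ b′)
  ++-independent {m = m} {n = n} linW b b′ indep-mod b′∈ indep′ c relation =
    ↑-cases (λ s → c s ≈ 0#) cˡ≈0 (indep′ cʳ y≋0)
    where
    open Subspace linW
    cˡ = c ∘ (_↑ˡ n)
    cʳ = c ∘ (m ↑ʳ_)
    x = combination cˡ b
    y = combination cʳ b′
    x+y≋0 : x +ᵥ y ≋ 0ᵥ
    x+y≋0 = ≋-trans (≋-sym (combination-++ c b b′)) relation
    cˡ≈0 : ∀ s → cˡ s ≈ 0#
    cˡ≈0 = indep-mod cˡ (respects
      (λ t → trans (solve 2 (λ x y → :- :1 :* y := x :- (x :+ y)) refl (x t) (y t))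
        (trans (+-congˡ (-‿cong (x+y≋0 t))) (solve 1 (λ x → x :- :0 := x) refl (x t))))
      (·-closed (- 1#) (combination-closed cʳ b′ b′∈)))
    y≋0 : y ≋ 0ᵥ
    y≋0 t = trans (trans (sym (+-identityˡ (y t))) (+-congʳ (sym (combination-zero cˡ b cˡ≈0 t)))) (x+y≋0 t)

  -- Projection along a direct sum decomposition.

  module Decomposition {d} {V W : Subset d} (linV : IsLinearSubspace V) (linW : IsLinearSubspace W)
                       (V⊕W : IsDirectSum V W) where

    private
      module V = Subspace linV
      module W = Subspace linW

    -- The difference `v -ᵥ v′` equals `w′ -ᵥ w`, so it lies in both summands and vanishes.
    unique : ∀ {v v′ w w′} → v ∈ V → v′ ∈ V → w ∈ W → w′ ∈ W → v +ᵥ w ≋ v′ +ᵥ w′ → v ≋ v′ × w ≋ w′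
    unique {v} {v′} {w} {w′} v∈ v′∈ w∈ w′∈ eq = v≋v′ , w≋w′
      where
      v-v′≋w′-w : v -ᵥ v′ ≋ w′ -ᵥ w
      v-v′≋w′-w t = begin
        v t - v′ t                    ≈⟨ solve 3 (λ v w v′ → v :- v′ := (v :+ w) :- (v′ :+ w)) refl (v t) (w t) (v′ t) ⟩
        v t + w t - (v′ t + w t)      ≈⟨ +-congʳ (eq t) ⟩
        v′ t + w′ t - (v′ t + w t)    ≈⟨ solve 3 (λ v w w′ → (v :+ w′) :- (v :+ w) := w′ :- w) refl (v′ t) (w t) (w′ t) ⟩
        w′ t - w t                    ∎
      v-v′≋0 : v -ᵥ v′ ≋ 0ᵥ
      v-v′≋0 = proj₂ V⊕W _ (V.minus-closed v∈ v′∈) (W.respects (≋-sym v-v′≋w′-w) (W.minus-closed w′∈ w∈))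
      x-y≈0⇒x≈y : ∀ {x y} → x - y ≈ 0# → x ≈ y
      x-y≈0⇒x≈y {x} {y} x-y≈0 = trans (solve 2 (λ x y → x := (x :- y) :+ y) refl x y)
        (trans (+-congʳ x-y≈0) (+-identityˡ y))
      v≋v′ : v ≋ v′
      v≋v′ t = x-y≈0⇒x≈y (v-v′≋0 t)
      w≋w′ : w ≋ w′
      w≋w′ t = sym (x-y≈0⇒x≈y (trans (sym (v-v′≋w′-w t)) (v-v′≋0 t)))

    -- The image of F under the projection onto V along W.
    Shadow : Subset d → Subset d
    Shadow F v = v ∈ V × ∃[ w ] (w ∈ W × v +ᵥ w ∈ F)

    module _ {F : Subset d} (linF : IsLinearSubspace F) where

      private module F = Subspace linF

      shadow-isLinearSubspace : IsLinearSubspace (Shadow F)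
      shadow-isLinearSubspace = record
        { respects = λ v≋v′ (v∈ , w , w∈ , v+w∈) →
            V.respects v≋v′ v∈ , w , w∈ , F.respects (+ᵥ-cong v≋v′ ≋-refl) v+w∈
        ; zero∈    = V.zero∈ , 0ᵥ , W.zero∈ , F.respects (λ _ → sym (+-identityˡ 0#)) F.zero∈
        ; +-closed = λ {x} {y} (x∈ , w , w∈ , x+w∈) (y∈ , z , z∈ , y+z∈) →
            V.+-closed x∈ y∈ , w +ᵥ z , W.+-closed w∈ z∈ ,
            F.respects (λ t → solve 4 (λ x w y z → (x :+ w) :+ (y :+ z) := (x :+ y) :+ (w :+ z)) refl
                                (x t) (w t) (y t) (z t))
              (F.+-closed x+w∈ y+z∈)
        ; ·-closed = λ a {x} (x∈ , w , w∈ , x+w∈) →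
            V.·-closed a x∈ , a ·ᵥ w , W.·-closed a w∈ ,
            F.respects (λ t → solve 3 (λ a x w → a :* (x :+ w) := a :* x :+ a :* w) refl a (x t) (w t))
              (F.·-closed a x+w∈)
        }

      ∩-isLinearSubspace : IsLinearSubspace (F ∩ W)
      ∩-isLinearSubspace = record
        { respects = λ x≋y (x∈F , x∈W) → F.respects x≋y x∈F , W.respects x≋y x∈W
        ; zero∈    = F.zero∈ , W.zero∈
        ; +-closed = λ (x∈F , x∈W) (y∈F , y∈W) → F.+-closed x∈F y∈F , W.+-closed x∈W y∈W
        ; ·-closed = λ a (x∈F , x∈W) → F.·-closed a x∈F , W.·-closed a x∈W
        }

      -- The projection restricted to `F` has image `Shadow F` and kernel `F ∩ W`. A basis of the
      -- image, lifted to `F`, together with a basis of the kernel is a basis of `F`.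
      rank-nullity : HasDimension (Shadow F) r → HasDimension (F ∩ W) t → HasDimension F (r ℕ.+ t)
      rank-nullity (g , g∈ , g-indep , g-spans) (h , h∈ , h-indep , h-spans) =
        f ++ h , ++-∈ {E = F} f h f∈ (proj₁ ∘ h∈) ,
        ++-independent linW f h f-indep (proj₂ ∘ h∈) h-indep , spans
        where
        w : Vector (ℝ^ d) _
        w s = proj₁ (proj₂ (g∈ s))
        w∈ : ∀ s → w s ∈ W
        w∈ s = proj₁ (proj₂ (proj₂ (g∈ s)))
        f : Vector (ℝ^ d) _
        f s = g s +ᵥ w s
        f∈ : ∀ s → f s ∈ F
        f∈ s = proj₂ (proj₂ (proj₂ (g∈ s)))
        f-indep : ∀ c → combination c f ∈ W → ∀ s → c s ≈ 0#
        -- A combination of the lifts that lies in `W` has V-part zero, and this V-part is the same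
        -- combination of `g`.
        f-indep c cf∈W = g-indep c (proj₁ (unique
          (V.combination-closed c g (proj₁ ∘ g∈)) V.zero∈ (W.combination-closed c w w∈) cf∈W
          (λ t → trans (sym (combination-+ʳ c g w t)) (sym (+-identityˡ _)))))
        spans : ∀ x → x ∈ F → x ∈ Span (f ++ h)
        spans x x∈ = from (proj₁ V⊕W x)
          where
          from : ∃[ v ] ∃[ y ] (v ∈ V × y ∈ W × x ≋ v +ᵥ y) → x ∈ Span (f ++ h)
          from (v , y , v∈ , y∈ , x≋) = c ++ c′ , λ t → begin
            x t
              ≈⟨ solve 2 (λ x z → x := z :+ (x :- z)) refl (x t) (combination c f t) ⟩
            combination c f t + (x t - combination c f t)
              ≈⟨ +-cong (combination-cong {b = f} (λ s → reflexive (≡.sym (lookup-++ˡ c c′ s))) (λ _ → ≋-refl) t)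
                        (trans (rest≋ t) (combination-cong {b = h} (λ s → reflexive (≡.sym (lookup-++ʳ c c′ s))) (λ _ → ≋-refl) t)) ⟩
            combination ((c ++ c′) ∘ (_↑ˡ _)) f t + combination ((c ++ c′) ∘ (_ ↑ʳ_)) h t
              ≈⟨ sym (combination-++ (c ++ c′) f h t) ⟩
            combination (c ++ c′) (f ++ h) t ∎
            where
            v∈Shadow : v ∈ Span g
            v∈Shadow = g-spans v (v∈ , y , y∈ , F.respects x≋ x∈)
            c = proj₁ v∈Shadow
            -- Subtracting the lift of the V-part of `x` leaves an element of `F` without V-part,
            -- that is, an element of the kernel.
            rest : ℝ^ d
            rest = x -ᵥ combination c f
            rest∈W : rest ∈ W
            rest∈W = W.respects (λ t → begin
              y t - combination c w t
                ≈⟨ solve 3 (λ v y w → y :- w := (v :+ y) :- (v :+ w)) refl (v t) (y t) (combination c w t) ⟩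
              v t + y t - (v t + combination c w t)
                ≈⟨ +-cong (sym (x≋ t)) (-‿cong (trans (+-congʳ (proj₂ v∈Shadow t)) (sym (combination-+ʳ c g w t)))) ⟩
              x t - combination c f t ∎)
              (W.minus-closed y∈ (W.combination-closed c w w∈))
            rest∈ : rest ∈ Span h
            rest∈ = h-spans rest (F.minus-closed x∈ (F.combination-closed c f f∈) , rest∈W)
            c′ = proj₁ rest∈
            rest≋ = proj₂ rest∈

    +ˢ-isLinearSubspace : IsLinearSubspace E → IsLinearSubspace E′ → IsLinearSubspace (E +ˢ E′)
    +ˢ-isLinearSubspace linE linE′ = record
      { respects = λ z≋z′ (x , y , x∈ , y∈ , z≋) → x , y , x∈ , y∈ , ≋-trans (≋-sym z≋z′) z≋
      ; zero∈    = 0ᵥ , 0ᵥ , E.zero∈ , E′.zero∈ , λ _ → sym (+-identityˡ 0#)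
      ; +-closed = λ (x , y , x∈ , y∈ , z≋) (x′ , y′ , x′∈ , y′∈ , z′≋) →
          x +ᵥ x′ , y +ᵥ y′ , E.+-closed x∈ x′∈ , E′.+-closed y∈ y′∈ ,
          λ t → trans (+-cong (z≋ t) (z′≋ t))
                  (solve 4 (λ x w y z → (x :+ w) :+ (y :+ z) := (x :+ y) :+ (w :+ z)) refl
                     (x t) (y t) (x′ t) (y′ t))
      ; ·-closed = λ a (x , y , x∈ , y∈ , z≋) →
          a ·ᵥ x , a ·ᵥ y , E.·-closed a x∈ , E′.·-closed a y∈ ,
          λ t → trans (*-congˡ (z≋ t)) (solve 3 (λ a x w → a :* (x :+ w) := a :* x :+ a :* w) refl a (x t) (y t))
      }
      where
      module E  = IsLinearSubspace linE
      module E′ = IsLinearSubspace linE′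

    -- Rank-nullity applies, because the shadow of `A +ˢ B` is `A` and its intersection with `W` is
    -- `B`.
    +ˢ-dimension : {A B : Subset d} → IsLinearSubspace A → IsLinearSubspace B → A ⊆ V → B ⊆ W →
                   HasDimension A r → HasDimension B t → HasDimension (A +ˢ B) (r ℕ.+ t)
    +ˢ-dimension {A = A} {B} linA linB A⊆V B⊆W dimA dimB =
      rank-nullity (+ˢ-isLinearSubspace linA linB)
        (dimension-resp-≐ (A⊆ , ⊆A) dimA) (dimension-resp-≐ (B⊆ , ⊆B) dimB)
      where
      module A = IsLinearSubspace linA
      module B = IsLinearSubspace linB
      A⊆ : A ⊆ Shadow (A +ˢ B)
      A⊆ {x} x∈ = A⊆V x∈ , 0ᵥ , W.zero∈ , x , 0ᵥ , x∈ , B.zero∈ , ≋-refl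
      ⊆A : Shadow (A +ˢ B) ⊆ A
      ⊆A (v∈ , w , w∈ , x , y , x∈ , y∈ , eq) =
        A.respects (≋-sym (proj₁ (unique v∈ (A⊆V x∈) w∈ (B⊆W y∈) eq))) x∈
      B⊆ : B ⊆ (A +ˢ B) ∩ W
      B⊆ {y} y∈ = (0ᵥ , y , A.zero∈ , y∈ , λ t → sym (+-identityˡ (y t))) , B⊆W y∈
      ⊆B : (A +ˢ B) ∩ W ⊆ B
      ⊆B {z} ((x , y , x∈ , y∈ , z≋) , z∈) = B.respects
        (proj₂ (unique (A⊆V x∈) V.zero∈ (B⊆W y∈) z∈ (λ t → trans (sym (z≋ t)) (sym (+-identityˡ (z t)))))) y∈

-- If `r` and `t` are the dimensions of image and kernel of a space of codimension `i`, then their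
-- codimensions in the two summands add up to `i`.
complement-+ : ∀ {ℓ e d i r t} → ℓ ℕ.+ e ≡ d → i ℕ.≤ d → r ℕ.≤ ℓ → t ℕ.≤ e → d ∸ i ≡ r ℕ.+ t →
               (ℓ ∸ r) ℕ.+ (e ∸ t) ≡ i
complement-+ {ℓ} {e} {d} {i} {r} {t} ℓ+e≡d i≤d r≤ℓ t≤e eq = ℕ.+-cancelʳ-≡ (r ℕ.+ t) _ i (begin
  (ℓ ∸ r) ℕ.+ (e ∸ t) ℕ.+ (r ℕ.+ t)  ≡⟨ interchange (ℓ ∸ r) (e ∸ t) r t ⟩
  (ℓ ∸ r) ℕ.+ r ℕ.+ (e ∸ t ℕ.+ t)    ≡⟨ ≡.cong₂ ℕ._+_ (ℕ.m∸n+n≡m r≤ℓ) (ℕ.m∸n+n≡m t≤e) ⟩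
  ℓ ℕ.+ e                            ≡⟨ ℓ+e≡d ⟩
  d                                  ≡⟨ ℕ.m+[n∸m]≡n i≤d ⟨
  i ℕ.+ (d ∸ i)                      ≡⟨ ≡.cong (i ℕ.+_) eq ⟩
  i ℕ.+ (r ℕ.+ t)                    ∎)
  where
  open ≡.≡-Reasoning
  open CommutativeSemigroup ℕ.+-commutativeSemigroup using (interchange)

-- This is `complement-+` with dimension and codimension exchanged.
complement-∸ : ∀ {ℓ e d j k} → ℓ ℕ.+ e ≡ d → j ℕ.≤ ℓ → k ℕ.≤ e → (ℓ ∸ j) ℕ.+ (e ∸ k) ≡ d ∸ (j ℕ.+ k)
complement-∸ {d = d} {j} {k} ≡.refl j≤ℓ k≤e =
  complement-+ ≡.refl (ℕ.m∸n≤m d (j ℕ.+ k)) j≤ℓ k≤e (ℕ.m∸[m∸n]≡n (ℕ.+-mono-≤ j≤ℓ k≤e))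

-- Dilates of convex bodies, flats and covering factors.

module CoveringMinima (em₁ : ExcludedMiddle (lsuc 0ℓ)) (ℝ : RealNumbers) where

  -- The existence of a flat missed by a covering is a statement in `Set₁`, hence the higher level
  -- of `em₁`; small propositions are decided by lifting them.
  em : ExcludedMiddle 0ℓ
  em {P} = map′ lower lift (em₁ {Lift (lsuc 0ℓ) P})

  open RealNumbers ℝ
  open Geometry ℝ
  open OrderedField em ℝ
  open LinearAlgebra em ℝ
  open CommutativeRing commutativeRing
    using (refl; sym; trans; +-cong; +-congˡ; +-congʳ; *-congˡ; *-congʳ; -‿cong; +-identityˡ; zeroʳ)
  open IsTotalOrder isTotalOrder
    using (total; ≤-respʳ-≈; ≤-respˡ-≈) renaming (trans to ≤-trans; reflexive to ≤-reflexive)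
  open RingSolver commutativeRing
  open import Data.Vec.Functional.Relation.Binary.Equality.Setoid setoid
    using (_≋_; ≋-refl)
  open import Relation.Binary.Reasoning.Setoid setoid

  private
    variable
      d k n : ℕ
      E C Γ : Subset d

  -- A convex set containing the origin contains `(u / v) ·ᵥ x` with each of its points `x`, so its
  -- dilates grow with the factor.
  scale-into : IsConvexBody E C → 0ᵥ ∈ C → ∀ {u v} → 0# ≤ u → u ≤ v → ∀ {x} → x ∈ C →
               ∃[ y ] (y ∈ C × v ·ᵥ y ≋ u ·ᵥ x)
  scale-into body 0∈C {u} {v} 0≤u u≤v {x} x∈C with ratio 0≤u u≤v
  ... | a , 0≤a , a≤1 , va≈u = a ·ᵥ x +ᵥ (1# - a) ·ᵥ 0ᵥ ,
    IsConvexBody.convex body x 0ᵥ a x∈C 0∈C 0≤a a≤1 ,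
    λ t → trans (solve 3 (λ v a x → v :* (a :* x :+ (:1 :- a) :* :0) := (v :* a) :* x) refl v a (x t))
                (*-congʳ va≈u)

  -- With `α = a / m`, the weight left for `L` is `m - a`, which is at least `b`; the slack is
  -- absorbed by moving `y` towards the origin.
  ⊕-scale : {K L : Subset d} → IsConvexBody E L → 0ᵥ ∈ L → ∀ {a b m} → 0# ≤ a → 0# ≤ b → a + b ≤ m →
            ∀ {x y} → x ∈ K → y ∈ L → (a ·ᵥ x +ᵥ b ·ᵥ y) ∈ m ·ˢ (K ⊕ L)
  ⊕-scale {K = K} {L} bodyL 0∈L {a} {b} {m} 0≤a 0≤b a+b≤m {x} {y} x∈ y∈ =
    combine (ratio 0≤a a≤m) (scale-into bodyL 0∈L 0≤b b≤m-a y∈)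
    where
    0≤m-[a+b] : 0# ≤ m - (a + b)
    0≤m-[a+b] = x≤y⇒0≤y-x a+b≤m
    a≤m : a ≤ m
    a≤m = 0≤y-x⇒x≤y (≤-respʳ-≈ (solve 3 (λ a b m → b :+ (m :- (a :+ b)) := m :- a) refl a b m)
                       (0≤x+y 0≤b 0≤m-[a+b]))
    b≤m-a : b ≤ m - a
    b≤m-a = 0≤y-x⇒x≤y (≤-respʳ-≈ (solve 3 (λ a b m → m :- (a :+ b) := (m :- a) :- b) refl a b m) 0≤m-[a+b])
    combine : ∃[ α ] (0# ≤ α × α ≤ 1# × m * α ≈ a) → ∃[ z ] (z ∈ L × (m - a) ·ᵥ z ≋ b ·ᵥ y) →
              (a ·ᵥ x +ᵥ b ·ᵥ y) ∈ m ·ˢ (K ⊕ L)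
    combine (α , 0≤α , α≤1 , mα≈a) (z , z∈ , eq) =
      α ·ᵥ x +ᵥ (1# - α) ·ᵥ z , (x , z , α , x∈ , z∈ , 0≤α , α≤1 , ≋-refl) , λ t → begin
        a * x t + b * y t               ≈⟨ +-congˡ (sym (eq t)) ⟩
        a * x t + (m - a) * z t         ≈⟨ +-cong (*-congʳ (sym mα≈a)) (*-congʳ (+-congˡ (-‿cong (sym mα≈a)))) ⟩
        m * α * x t + (m - m * α) * z t ≈⟨ solve 4 (λ m α x z → m :* α :* x :+ (m :- m :* α) :* z := m :* (α :* x :+ (:1 :- α) :* z)) refl m α (x t) (z t) ⟩
        m * (α * x t + (1# - α) * z t)  ∎

  Flat : ℝ^ d → Subset d → Subset d
  Flat p F x = x -ᵥ p ∈ F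

  p∈Flat : ∀ {p} {F : Subset d} → IsLinearSubspace F → p ∈ Flat p F
  p∈Flat {p = p} lin = respects (λ t → solve 1 (λ p → :0 := p :- p) refl (p t)) zero∈
    where open IsLinearSubspace lin

  flat-isAffineSubspace : IsLinearSubspace E → ∀ {p} {F : Subset d} → p ∈ E → IsLinearSubspace F → F ⊆ E →
                          HasDimension F n → IsAffineSubspace E n (Flat p F)
  flat-isAffineSubspace linE {p} {F} p∈ linF F⊆E dim =
    (λ {x} x-p∈F → respects (λ t → solve 2 (λ x p → (x :- p) :+ p := x) refl (x t) (p t)) (+-closed (F⊆E x-p∈F) p∈)) ,
    p , F , linF , dim , (λ x∈ → x∈) , (λ x∈ → x∈)
    where open IsLinearSubspace linE

  -- Each direction is the difference of two points of the flat, `x +ᵥ p` and `p`.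
  flat-⊆⇒direction-⊆ : IsLinearSubspace E → ∀ {p} {F : Subset d} → IsLinearSubspace F → Flat p F ⊆ E → F ⊆ E
  flat-⊆⇒direction-⊆ linE {p} linF Flat⊆ {x} x∈ =
    E.respects (λ t → solve 2 (λ x p → (x :+ p) :- p := x) refl (x t) (p t))
      (E.minus-closed (Flat⊆ (F.respects (λ t → solve 2 (λ x p → x := (x :+ p) :- p) refl (x t) (p t)) x∈))
                      (Flat⊆ (p∈Flat linF)))
    where
    module E = Subspace linE
    module F = Subspace linF

  -- For j = 0 this says that the convention μ₀ = 0 agrees with the general definition.
  isMinimum : IsLinearSubspace E → HasDimension E k → 0ᵥ ∈ C → 0ᵥ ∈ Γ → ∀ j {m} →
              IsCoveringMinimum E k C Γ j m → IsMinimum (CoveringFactor E k C Γ j) m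
  isMinimum linE dimE 0∈C 0∈Γ (suc j) min = min
  isMinimum {E = E} {C = C} {Γ} linE dimE 0∈C 0∈Γ zero {m} (lift m≈0) =
    (≤-reflexive (sym m≈0) , covers) , λ x (0≤x , _) → ≤-respˡ-≈ (sym m≈0) 0≤x
    where
    module E = Subspace linE
    covers : ∀ U → IsAffineSubspace E _ U → Satisfiable ((m ·ˢ C +ˢ Γ) ∩ U)
    covers U (U⊆E , p , F , linF , dimF , U⊆ , ⊆U) =
      -- A flat of full dimension in `E` is all of `E`, so the origin serves as the covered point.
      0ᵥ , (0ᵥ , 0ᵥ , (0ᵥ , 0∈C , λ _ → sym (zeroʳ m)) , 0∈Γ , λ _ → sym (+-identityˡ 0#)) ,
      ⊆U (E⊆F (E.minus-closed E.zero∈ (U⊆E (⊆U (p∈Flat linF)))))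
      where
      E⊆F : E ⊆ F
      E⊆F = same-dimension⇒⊇ linF (flat-⊆⇒direction-⊆ linE linF (λ x∈ → U⊆E (⊆U x∈))) dimF dimE

  -- The flat is recorded by a point and a direction, so that flats in `V` and `W` can be added. The
  -- guard `0# ≤ a` admits negative `a`, which can arise when a factor is split in two.
  UncoveredFlat : Subset d → Subset d → Subset d → Carrier → ℕ → Set₁
  UncoveredFlat {d} E C Γ a n =
    ∃[ p ] Σ[ F ∈ Subset d ] (p ∈ E × F ⊆ E × IsLinearSubspace F × HasDimension F n
      × (0# ≤ a → ¬ Satisfiable ((a ·ˢ C +ˢ Γ) ∩ Flat p F)))

  -- A negative a is never a covering factor, so then any flat will do.
  uncovered-flat : IsLinearSubspace E → HasDimension E k → ∀ {j m a} →
    IsMinimum (CoveringFactor E k C Γ j) m → ¬ (m ≤ a) →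
    UncoveredFlat E C Γ a (k ∸ j)
  uncovered-flat {d} {E} {k} {C} {Γ} linE dimE {j} {m} {a} (_ , least) m≰a = by-sign em
    where
    Missed : Set₁
    Missed = Σ[ U ∈ Subset d ] (IsAffineSubspace E (k ∸ j) U × ¬ Satisfiable ((a ·ˢ C +ˢ Γ) ∩ U))
    any-flat : ¬ (0# ≤ a) → Σ[ F ∈ Subset d ] (IsLinearSubspace F × F ⊆ E × HasDimension F (k ∸ j)) →
               UncoveredFlat E C Γ a (k ∸ j)
    any-flat 0≰a (F , linF , F⊆E , dimF) =
      0ᵥ , F , IsLinearSubspace.zero∈ linE , F⊆E , linF , dimF , λ 0≤a → contradiction 0≤a 0≰a
    missed-flat : 0# ≤ a → Dec Missed → UncoveredFlat E C Γ a (k ∸ j)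
    -- If no flat is missed, `a` is a covering factor, and minimality gives `m ≤ a`.
    missed-flat 0≤a (no none) = contradiction
      (least a (0≤a , λ U aff → decidable-stable em λ missed → none (U , aff , missed))) m≰a
    missed-flat 0≤a (yes (U , (U⊆E , p , F , linF , dimF , U⊆ , ⊆U) , missed)) =
      p , F , U⊆E (⊆U (p∈Flat linF)) , flat-⊆⇒direction-⊆ linE linF (λ x∈ → U⊆E (⊆U x∈)) , linF , dimF ,
      λ _ (x , x∈ , x∈F) → missed (x , x∈ , ⊆U x∈F)
    by-sign : Dec (0# ≤ a) → UncoveredFlat E C Γ a (k ∸ j)
    by-sign (no  0≰a) = any-flat 0≰a (subspace-of-dimension linE dimE (ℕ.m∸n≤m k j))
    by-sign (yes 0≤a) = missed-flat 0≤a em₁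

  -- The common point `p +ᵥ f` stays fixed; only its summand `u ·ᵥ x` is rewritten as `v ·ᵥ y` with
  -- `y` in the body.
  meets-mono : IsConvexBody E C → 0ᵥ ∈ C → ∀ {u v} → 0# ≤ u → u ≤ v →
               ∀ {p F x g f} → IsLinearSubspace F → x ∈ C → g ∈ Γ → f ∈ F → u ·ᵥ x +ᵥ g ≋ p +ᵥ f →
               Satisfiable ((v ·ˢ C +ˢ Γ) ∩ Flat p F)
  meets-mono {C = C} body 0∈C {u} {v} 0≤u u≤v {p} {F} {x} {g} {f} linF x∈ g∈ f∈ eq =
    p +ᵥ f ,
    (v ·ᵥ y , g , (y , proj₁ (proj₂ scaled) , ≋-refl) , g∈ ,
      λ t → trans (sym (eq t)) (+-congʳ (sym (proj₂ (proj₂ scaled) t)))) ,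
    IsLinearSubspace.respects linF (λ t → solve 2 (λ p f → f := (p :+ f) :- p) refl (p t) (f t)) f∈
    where
    scaled : ∃[ y ] (y ∈ C × v ·ᵥ y ≋ u ·ᵥ x)
    scaled = scale-into body 0∈C 0≤u u≤v x∈
    y = proj₁ scaled

  -- The two inequalities for the direct sum.

  module DirectSum
    {d ℓ e : ℕ} (ℓ+e≡d : ℓ ℕ.+ e ≡ d) {V W : Subset d} (linV : IsLinearSubspace V) (linW : IsLinearSubspace W)
    (V⊕W : IsDirectSum V W) (dimV : HasDimension V ℓ) (dimW : HasDimension W e)
    {K L : Subset d} (bodyK : IsConvexBody V K) (bodyL : IsConvexBody W L) (0∈K : 0ᵥ ∈ K) (0∈L : 0ᵥ ∈ L)
    {Λ Γ : Subset d} (latΛ : IsLattice V Λ) (latΓ : IsLattice W Γ) where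

    open Decomposition linV linW V⊕W
    private
      module V = Subspace linV
      module W = Subspace linW
      module K = IsConvexBody bodyK
      module L = IsConvexBody bodyL
      module Λ = IsLattice latΛ
      module Γ = IsLattice latΓ

    -- Write `p` as `v₀ +ᵥ w₀`. If `w` lifts `x -ᵥ v₀` to `F`, the fibre of the flat over `x` is the
    -- translate of `F ∩ W` by `w₀ +ᵥ w`, and the covering by `L` supplies a point of it.
    meets-direct-sum : ∀ {j k α β m} →
      α ∈ CoveringFactor V ℓ K Λ j → β ∈ CoveringFactor W e L Γ k → α + β ≤ m →
      ∀ {p F} → IsLinearSubspace F → HasDimension (Shadow F) (ℓ ∸ j) → HasDimension (F ∩ W) (e ∸ k) →
      Satisfiable ((m ·ˢ (K ⊕ L) +ˢ (Λ +ˢ Γ)) ∩ Flat p F)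
    meets-direct-sum {α = α} {β} {m} (0≤α , coverK) (0≤β , coverL) α+β≤m {p} {F} linF dimG dimH =
      in-V (proj₁ V⊕W p)
      where
      module F = IsLinearSubspace linF
      Goal : Set
      Goal = Satisfiable ((m ·ˢ (K ⊕ L) +ˢ (Λ +ˢ Γ)) ∩ Flat p F)
      module _ {v₀ w₀ : ℝ^ d} (p≋ : p ≋ v₀ +ᵥ w₀) where
        in-both : ∀ {x w} → x ∈ (α ·ˢ K +ˢ Λ) → (x -ᵥ v₀) +ᵥ w ∈ F →
                  Satisfiable ((β ·ˢ L +ˢ Γ) ∩ Flat (w₀ +ᵥ w) (F ∩ W)) → Goal
        in-both {x} {w} (x₁ , λ₁ , (x₂ , x₂∈ , x₁≋) , λ₁∈ , x≋) x-v₀+w∈F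
                (y , (y₁ , γ₁ , (y₂ , y₂∈ , y₁≋) , γ₁∈ , y≋) , (y-w∈F , _)) =
          x +ᵥ y ,
          (α ·ᵥ x₂ +ᵥ β ·ᵥ y₂ , λ₁ +ᵥ γ₁ , ⊕-scale bodyL 0∈L 0≤α 0≤β α+β≤m x₂∈ y₂∈ ,
            (λ₁ , γ₁ , λ₁∈ , γ₁∈ , ≋-refl) ,
            λ t → trans (+-cong (trans (x≋ t) (+-congʳ (x₁≋ t))) (trans (y≋ t) (+-congʳ (y₁≋ t))))
              (solve 4 (λ a b c d → (a :+ b) :+ (c :+ d) := (a :+ c) :+ (b :+ d)) refl
                 (α * x₂ t) (λ₁ t) (β * y₂ t) (γ₁ t))) ,
          -- The auxiliary `w` cancels when the two elements of `F` are added, leaving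
          -- `x +ᵥ y -ᵥ p`.
          F.respects (λ t → trans
            (solve 5 (λ x y v w z → ((x :- v) :+ w) :+ (y :- (z :+ w)) := (x :+ y) :- (v :+ z)) refl
               (x t) (y t) (v₀ t) (w t) (w₀ t))
            (+-congˡ (-‿cong (sym (p≋ t))))) (F.+-closed x-v₀+w∈F y-w∈F)
        in-W : w₀ ∈ W → Satisfiable ((α ·ˢ K +ˢ Λ) ∩ Flat v₀ (Shadow F)) → Goal
        in-W w₀∈ (x , x∈ , (_ , w , w∈ , x-v₀+w∈F)) = in-both x∈ x-v₀+w∈F
          (coverL (Flat (w₀ +ᵥ w) (F ∩ W))
            (flat-isAffineSubspace linW (W.+-closed w₀∈ w∈) (∩-isLinearSubspace linF) proj₂ dimH))
      in-V : ∃[ v₀ ] ∃[ w₀ ] (v₀ ∈ V × w₀ ∈ W × p ≋ v₀ +ᵥ w₀) → Goal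
      in-V (v₀ , w₀ , v₀∈ , w₀∈ , p≋) = in-W p≋ w₀∈
        (coverK (Flat v₀ (Shadow F)) (flat-isAffineSubspace linV v₀∈ (shadow-isLinearSubspace linF) proj₁ dimG))

    module _ {μK μL : ℕ → Carrier}
      (minK : ∀ j → j ℕ.≤ ℓ → IsMinimum (CoveringFactor V ℓ K Λ j) (μK j))
      (minL : ∀ j → j ℕ.≤ e → IsMinimum (CoveringFactor W e L Γ j) (μL j)) where

      -- For each direction `F` the indices are the codimensions of its shadow in `V` and of `F ∩ W`
      -- in `W`; rank-nullity makes them sum to `i`, so `bound` applies.
      upper : ∀ {i m} → i ℕ.≤ d → 0# ≤ m → (∀ j k → j ℕ.≤ ℓ → k ℕ.≤ e → j ℕ.+ k ≡ i → μK j + μL k ≤ m) →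
              m ∈ CoveringFactor whole d (K ⊕ L) (Λ +ˢ Γ) i
      upper {i} {m} i≤d 0≤m bound = 0≤m , covers
        where
        meets : ∀ {r t p F} → IsLinearSubspace F → HasDimension F (d ∸ i) →
                HasDimension (Shadow F) r → HasDimension (F ∩ W) t →
                Satisfiable ((m ·ˢ (K ⊕ L) +ˢ (Λ +ˢ Γ)) ∩ Flat p F)
        meets {r} {t} {p} {F} linF dimF dimG dimH =
          meets-direct-sum {ℓ ∸ r} {e ∸ t} (proj₁ (minK (ℓ ∸ r) j≤ℓ)) (proj₁ (minL (e ∸ t) k≤e))
            (bound (ℓ ∸ r) (e ∸ t) j≤ℓ k≤e
              (complement-+ ℓ+e≡d i≤d r≤ℓ t≤e (dimension-unique dimF (rank-nullity linF dimG dimH))))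
            linF
            (≡.subst (HasDimension (Shadow F)) (≡.sym (ℕ.m∸[m∸n]≡n r≤ℓ)) dimG)
            (≡.subst (HasDimension (F ∩ W)) (≡.sym (ℕ.m∸[m∸n]≡n t≤e)) dimH)
          where
          r≤ℓ : r ℕ.≤ ℓ
          r≤ℓ = dimension-mono proj₁ dimG dimV
          t≤e : t ℕ.≤ e
          t≤e = dimension-mono proj₂ dimH dimW
          j≤ℓ : ℓ ∸ r ℕ.≤ ℓ
          j≤ℓ = ℕ.m∸n≤m ℓ r
          k≤e : e ∸ t ℕ.≤ e
          k≤e = ℕ.m∸n≤m e t
        covers : ∀ U → IsAffineSubspace whole (d ∸ i) U → Satisfiable ((m ·ˢ (K ⊕ L) +ˢ (Λ +ˢ Γ)) ∩ U)
        covers U (_ , p , F , linF , dimF , _ , ⊆U) = z , z∈ , ⊆U z∈F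
          where
          point : Satisfiable ((m ·ˢ (K ⊕ L) +ˢ (Λ +ˢ Γ)) ∩ Flat p F)
          point = meets linF dimF (proj₂ (dimension-exists (shadow-isLinearSubspace linF)))
                                  (proj₂ (dimension-exists (∩-isLinearSubspace linF)))
          z = proj₁ point
          z∈ = proj₁ (proj₂ point)
          z∈F = proj₂ (proj₂ point)

      lower-bound : ∀ {j k μ} → j ℕ.≤ ℓ → k ℕ.≤ e → μ ∈ CoveringFactor whole d (K ⊕ L) (Λ +ˢ Γ) (j ℕ.+ k) →
                    μK j + μL k ≤ μ
      lower-bound {j} {k} {μ} j≤ℓ k≤e (0≤μ , covers) = decidable-stable em λ s≰μ →
        separate (uncovered-flat linV dimV {j} (minK j j≤ℓ) (below s≰μ (μK j)))
                 (uncovered-flat linW dimW {k} (minL k k≤e) (below s≰μ (μL k)))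
        where
        -- Half of the deficit is taken from each minimum, so that the reduced factors `a` and `b`
        -- add up to exactly `μ`.
        δ = proj₁ half * (μK j + μL k - μ)
        δ+δ≈ : δ + δ ≈ μK j + μL k - μ
        δ+δ≈ = trans (solve 2 (λ h x → h :* x :+ h :* x := (h :+ h) :* x) refl (proj₁ half) (μK j + μL k - μ))
          (trans (*-congʳ (proj₂ half)) (solve 1 (λ x → :1 :* x := x) refl (μK j + μL k - μ)))
        a b : Carrier
        a = μK j - δ
        b = μL k - δ
        a+b≈μ : a + b ≈ μ
        a+b≈μ = trans (solve 3 (λ x y z → (x :- z) :+ (y :- z) := (x :+ y) :- (z :+ z)) refl (μK j) (μL k) δ)
          (trans (+-congˡ (-‿cong δ+δ≈)) (solve 2 (λ x y → x :- (x :- y) := y) refl (μK j + μL k) μ))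
        -- If `x ≤ x - δ`, then `δ + δ`, which is the deficit, is at most 0.
        below : ¬ (μK j + μL k ≤ μ) → ∀ x → ¬ (x ≤ x - δ)
        below s≰μ x x≤x-δ = s≰μ (0≤y-x⇒x≤y (≤-respʳ-≈ (begin
          (x - δ - x) + (x - δ - x)  ≈⟨ solve 2 (λ x d → ((x :- d) :- x) :+ ((x :- d) :- x) := :- (d :+ d)) refl x δ ⟩
          - (δ + δ)                  ≈⟨ -‿cong δ+δ≈ ⟩
          - (μK j + μL k - μ)        ≈⟨ solve 2 (λ x y → :- (x :- y) := y :- x) refl (μK j + μL k) μ ⟩
          μ - (μK j + μL k)          ∎)
          (0≤x+y (x≤y⇒0≤y-x x≤x-δ) (x≤y⇒0≤y-x x≤x-δ))))
        module Separate {p q : ℝ^ d} {A B : Subset d} (p∈ : p ∈ V) (q∈ : q ∈ W) (A⊆V : A ⊆ V) (B⊆W : B ⊆ W)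
          (linA : IsLinearSubspace A) (linB : IsLinearSubspace B)
          (missA : 0# ≤ a → ¬ Satisfiable ((a ·ˢ K +ˢ Λ) ∩ Flat p A))
          (missB : 0# ≤ b → ¬ Satisfiable ((b ·ˢ L +ˢ Γ) ∩ Flat q B)) where
          avoids : ¬ Satisfiable ((μ ·ˢ (K ⊕ L) +ˢ (Λ +ˢ Γ)) ∩ Flat (p +ᵥ q) (A +ˢ B))
          avoids (z , (z₁ , g , (c , (x , y , τ , x∈ , y∈ , 0≤τ , τ≤1 , c≋) , z₁≋) , (λ₁ , γ₁ , λ₁∈ , γ₁∈ , g≋) , z≋)
                    , (f , h , f∈ , h∈ , z-p-q≋)) = contradict (total (μ * τ) a)
            where
            -- The common point is written twice as a V-part plus a W-part, and uniqueness equates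
            -- the parts.
            parts : (μ * τ) ·ᵥ x +ᵥ λ₁ ≋ p +ᵥ f × (μ * (1# - τ)) ·ᵥ y +ᵥ γ₁ ≋ q +ᵥ h
            parts = unique (V.+-closed (V.·-closed _ (K.⊆-space x∈)) (Λ.⊆-space λ₁∈)) (V.+-closed p∈ (A⊆V f∈))
                           (W.+-closed (W.·-closed _ (L.⊆-space y∈)) (Γ.⊆-space γ₁∈)) (W.+-closed q∈ (B⊆W h∈))
              λ t → begin
                μ * τ * x t + λ₁ t + (μ * (1# - τ) * y t + γ₁ t)
                  ≈⟨ solve 6 (λ m a x l y g → (m :* a :* x :+ l) :+ (m :* (:1 :- a) :* y :+ g)
                                            := m :* (a :* x :+ (:1 :- a) :* y) :+ (l :+ g)) refl
                       μ τ (x t) (λ₁ t) (y t) (γ₁ t) ⟩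
                μ * (τ * x t + (1# - τ) * y t) + (λ₁ t + γ₁ t)
                  ≈⟨ sym (trans (z≋ t) (+-cong (trans (z₁≋ t) (*-congˡ (c≋ t))) (g≋ t))) ⟩
                z t
                  ≈⟨ solve 3 (λ z p q → z := (p :+ q) :+ (z :- (p :+ q))) refl (z t) (p t) (q t) ⟩
                p t + q t + (z t - (p t + q t))
                  ≈⟨ +-congˡ (z-p-q≋ t) ⟩
                p t + q t + (f t + h t)
                  ≈⟨ solve 4 (λ p q f h → (p :+ q) :+ (f :+ h) := (p :+ f) :+ (q :+ h)) refl (p t) (q t) (f t) (h t) ⟩
                p t + f t + (q t + h t) ∎
            0≤μτ : 0# ≤ μ * τ
            0≤μτ = *-nonNegative 0≤μ 0≤τ
            0≤μ[1-τ] : 0# ≤ μ * (1# - τ)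
            0≤μ[1-τ] = *-nonNegative 0≤μ (x≤y⇒0≤y-x τ≤1)
            -- In either case a non-negative number lies below `a` or `b`, so the guard of the
            -- corresponding missed flat is satisfied.
            contradict : μ * τ ≤ a ⊎ a ≤ μ * τ → ⊥
            contradict (inj₁ μτ≤a) =
              missA (≤-trans 0≤μτ μτ≤a) (meets-mono bodyK 0∈K 0≤μτ μτ≤a linA x∈ λ₁∈ f∈ (proj₁ parts))
            contradict (inj₂ a≤μτ) =
              missB (≤-trans 0≤μ[1-τ] μ[1-τ]≤b) (meets-mono bodyL 0∈L 0≤μ[1-τ] μ[1-τ]≤b linB y∈ γ₁∈ h∈ (proj₂ parts))
              where
              μ[1-τ]≤b : μ * (1# - τ) ≤ b
              μ[1-τ]≤b = 0≤y-x⇒x≤y (≤-respʳ-≈ (begin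
                -- The term `a + b - μ` is introduced in order to be replaced by `μ - μ`.
                μ * τ - a                  ≈⟨ solve 4 (λ m t a b → m :* t :- a := ((a :+ b) :- m :* (:1 :- t)) :- ((a :+ b) :- m) :- a) refl μ τ a b ⟩
                a + b - μ * (1# - τ) - (a + b - μ) - a
                                           ≈⟨ +-congʳ (+-congˡ (-‿cong (+-congʳ a+b≈μ))) ⟩
                a + b - μ * (1# - τ) - (μ - μ) - a
                                           ≈⟨ solve 4 (λ m t a b → ((a :+ b) :- m :* (:1 :- t)) :- (m :- m) :- a := b :- m :* (:1 :- t)) refl μ τ a b ⟩
                b - μ * (1# - τ)           ∎) (x≤y⇒0≤y-x a≤μτ))
        separate : UncoveredFlat V K Λ a (ℓ ∸ j) → ¬ UncoveredFlat W L Γ b (e ∸ k)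
        separate (p , A , p∈ , A⊆V , linA , dimA , missA) (q , B , q∈ , B⊆W , linB , dimB , missB) =
          Separate.avoids p∈ q∈ A⊆V B⊆W linA linB missA missB
            (covers (Flat (p +ᵥ q) (A +ˢ B)) (flat-isAffineSubspace whole-lin _ (+ˢ-isLinearSubspace linA linB) _ dimA+B))
          where
          whole-lin : IsLinearSubspace whole
          whole-lin = record { respects = _ ; zero∈ = _ ; +-closed = _ ; ·-closed = _ }
          dimA+B : HasDimension (A +ˢ B) (d ∸ (j ℕ.+ k))
          dimA+B = ≡.subst (HasDimension (A +ˢ B)) (complement-∸ ℓ+e≡d j≤ℓ k≤e)
                     (+ˢ-dimension linA linB A⊆V B⊆W dimA dimB)

-- Existence of the maximum and the resulting formula.

theorem1p2 :
  ExcludedMiddle (lsuc 0ℓ) →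
  (ℝ : RealNumbers) →
  let open RealNumbers ℝ
      open Geometry ℝ
  in
  (d ℓ : ℕ) → ℓ ℕ.≤ d →
  (V W : Subset d) →
  IsLinearSubspace V → IsLinearSubspace W →
  IsDirectSum V W →
  HasDimension V ℓ → HasDimension W (d ∸ ℓ) →
  (K L : Subset d) →
  IsConvexBody V K → IsConvexBody W L →
  0ᵥ ∈ K → 0ᵥ ∈ L →
  (Λ Γ : Subset d) →
  IsLattice V Λ → IsLattice W Γ →
  (μK μL : ℕ → Carrier) →
  (∀ j → j ℕ.≤ ℓ → IsCoveringMinimum V ℓ K Λ j (μK j)) →
  (∀ j → j ℕ.≤ d ∸ ℓ → IsCoveringMinimum W (d ∸ ℓ) L Γ j (μL j)) →
  (i : ℕ) → 1 ℕ.≤ i → i ℕ.≤ d →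
  ∃[ m ]
    (IsCoveringMinimum whole d (K ⊕ L) (Λ +ˢ Γ) i m
    × IsMaximum
        (λ s → ∃[ j ] (j ℕ.≤ ℓ × j ℕ.≤ i × i ∸ j ℕ.≤ d ∸ ℓ × s ≈ μK j + μL (i ∸ j)))
        m)
theorem1p2 em₁ ℝ d ℓ ℓ≤d V W linV linW V⊕W dimV dimW K L bodyK bodyL 0∈K 0∈L Λ Γ latΛ latΓ μK μL minK minL
           i@(suc _) _ i≤d =
  conclude (maximiser Admissible value ℓ (proj₁ admissible , proj₁ (proj₂ admissible) , proj₂ admissible))
  where
  open RealNumbers ℝ
  open Geometry ℝ
  open CommutativeRing commutativeRing using (refl; sym)
  open IsTotalOrder isTotalOrder using (≤-respˡ-≈)
  open CoveringMinima em₁ ℝ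
  open OrderedField em ℝ using (0≤x+y; maximiser)
  open DirectSum (ℕ.m+[n∸m]≡n ℓ≤d) linV linW V⊕W dimV dimW bodyK bodyL 0∈K 0∈L latΛ latΓ

  -- The clause `j ≤ i` keeps `i ∸ j` from being truncated.
  Admissible : ℕ → Set
  Admissible j = j ℕ.≤ ℓ × j ℕ.≤ i × i ∸ j ℕ.≤ d ∸ ℓ

  value : ℕ → Carrier
  value j = μK j + μL (i ∸ j)

  -- The smaller of `i` and `ℓ` is admissible, so the maximum ranges over a nonempty set.
  admissible : ∃[ j ] Admissible j
  admissible with ℕ.≤-total i ℓ
  ... | inj₁ i≤ℓ = i , i≤ℓ , ℕ.≤-refl , ≡.subst (ℕ._≤ d ∸ ℓ) (≡.sym (ℕ.n∸n≡0 i)) ℕ.z≤n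
  ... | inj₂ ℓ≤i = ℓ , ℕ.≤-refl , ℓ≤i , ℕ.∸-monoˡ-≤ ℓ i≤d

  -- Replacing the convention at index 0 by the general minimum property lets both inequalities
  -- treat all indices alike.
  minK′ : ∀ j → j ℕ.≤ ℓ → IsMinimum (CoveringFactor V ℓ K Λ j) (μK j)
  minK′ j j≤ℓ = isMinimum linV dimV 0∈K (IsLattice.zero∈ latΛ) j (minK j j≤ℓ)

  minL′ : ∀ j → j ℕ.≤ d ∸ ℓ → IsMinimum (CoveringFactor W (d ∸ ℓ) L Γ j) (μL j)
  minL′ j j≤e = isMinimum linW dimW 0∈L (IsLattice.zero∈ latΓ) j (minL j j≤e)

  bound : ∀ {m} → (∀ j → j ℕ.≤ ℓ → Admissible j → value j ≤ m) →
          ∀ j k → j ℕ.≤ ℓ → k ℕ.≤ d ∸ ℓ → j ℕ.+ k ≡ i → μK j + μL k ≤ m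
  bound {m} max j k j≤ℓ k≤e j+k≡i = ≡.subst (λ n → μK j + μL n ≤ m) i-j≡k
    (max j j≤ℓ (j≤ℓ , ≡.subst (j ℕ.≤_) j+k≡i (ℕ.m≤m+n j k) , ≡.subst (ℕ._≤ d ∸ ℓ) (≡.sym i-j≡k) k≤e))
    where
    i-j≡k : i ∸ j ≡ k
    i-j≡k = ≡.trans (≡.cong (_∸ j) (≡.sym j+k≡i)) (ℕ.m+n∸m≡n j k)

  conclude : ∃[ j ] (Admissible j × (∀ k → k ℕ.≤ ℓ → Admissible k → value k ≤ value j)) →
    ∃[ m ]
      (IsCoveringMinimum whole d (K ⊕ L) (Λ +ˢ Γ) i m
      × IsMaximum
          (λ s → ∃[ j ] (j ℕ.≤ ℓ × j ℕ.≤ i × i ∸ j ℕ.≤ d ∸ ℓ × s ≈ μK j + μL (i ∸ j)))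
          m)
  conclude (j , (j≤ℓ , j≤i , i-j≤e) , max) =
    value j ,
    (upper minK′ minL′ i≤d (0≤x+y (proj₁ (proj₁ (minK′ j j≤ℓ))) (proj₁ (proj₁ (minL′ (i ∸ j) i-j≤e)))) (bound max) ,
     -- Since `j ≤ i`, the index `i` can be rewritten as `j + (i ∸ j)`, the form in which the lower
     -- bound splits it.
     λ μ μ-covers → lower-bound minK′ minL′ j≤ℓ i-j≤e
       (≡.subst (λ n → μ ∈ CoveringFactor whole d (K ⊕ L) (Λ +ˢ Γ) n) (≡.sym (ℕ.m+[n∸m]≡n j≤i)) μ-covers)) ,
    (j , j≤ℓ , j≤i , i-j≤e , refl) ,
    λ s (k , k≤ℓ , k≤i , i-k≤e , s≈) → ≤-respˡ-≈ (sym s≈) (max k k≤ℓ (k≤ℓ , k≤i , i-k≤e))
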